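{- Let $\alpha,\nu$ be positive integers. (a) If $2\alpha<3(\nu+1)$, then $e_1(\alpha,\nu)=\binom{2\nu+1}{2}$ and $E_1(\alpha,\nu)=\{G_{\alpha,\nu}\}$ (up to isomorphism). (b) If $2\alpha>3(\nu+1)$, then $e_1(\alpha,\nu)=\alpha\nu+\binom{\nu}{2}$ and $E_1(\alpha,\nu)=\{H_{\alpha,\nu}\}$ (up to isomorphism). (c) If $2\alpha=3(\nu+1)$, then $e_1(\alpha,\nu)=\binom{2\nu+1}{2}=\alpha\nu+\binom{\nu}{2}$ and $E_1(\alpha,\nu)=\{G_{\alpha,\nu},H_{\alpha,\nu}\}$ (up to isomorphism).
   Context: All graphs are finite and simple; $\alpha(G)$ denotes the independence number and $\nu(G)$ the size of a maximum matching. For positive integers $\alpha,\nu$, let $e_1(\alpha,\nu)=\max\{|E(G)|:\alpha(G)=\alpha,\ \nu(G)=\nu\}$, and let $E_1(\alpha,\nu)$ be the set of graphs $G$ with $\alpha(G)=\alpha$, $\nu(G)=\nu$ and $|E(G)|=e_1(\alpha,\nu)$. $G_{\alpha,\nu}$ is the graph whose components are one $K_{2\nu+1}$ and $\alpha-1$ isolated vertices. $H_{\alpha,\nu}$ is obtained from the complete bipartite graph $K_{\alpha,\nu}$ by adding all $\binom{\nu}{2}$ edges among the vertices of the part of size $\nu$. -}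

module Defs where

open import Data.Bool using (Bool; true; false; not; _∧_; _∨_; T)
open import Data.Bool.Properties using (∧-comm; ∨-comm)
open import Data.Nat using (ℕ; zero; suc; _+_; _*_; _∸_; _≤_; _<?_; _≤?_)
open import Data.Fin using (Fin; toℕ; _≟_)
open import Data.Fin.Subset using (Subset; _∈_; ∣_∣)
open import Data.List using (List; []; _∷_; length; concatMap; allFin)
open import Data.List.Relation.Unary.All using (All)
open import Data.List.Relation.Unary.Any using (Any)
open import Data.List.Relation.Unary.Unique.Propositional using (Unique)
open import Data.Product using (Σ; _×_; _,_; proj₁; proj₂)
open import Data.Empty using (⊥-elim)
open import Function.Bundles using (_↔_; Inverse)
open import Relation.Nullary using (does; yes; no)
open import Relation.Binary.PropositionalEquality using (_≡_; refl; cong₂)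

record Graph : Set where
  field
    n     : ℕ
    adj   : Fin n → Fin n → Bool
    sym   : ∀ i j → adj i j ≡ adj j i
    irrefl : ∀ i → adj i i ≡ false
open Graph public

countRow : ∀ {n} → (Fin n → Bool) → (Fin n → ℕ)
countRow {n} f i = count (allFin n)
  where
  count : List (Fin n) → ℕ
  count [] = 0
  count (j ∷ js) with does (toℕ i <? toℕ j) ∧ f j
  ... | true  = suc (count js)
  ... | false = count js

sumFin : (n : ℕ) → (Fin n → ℕ) → ℕ
sumFin zero    f = 0
sumFin (suc n) f = f Fin.zero + sumFin n (λ i → f (Fin.suc i))
  where import Data.Fin as Fin

edges : Graph → ℕ
edges G = sumFin (n G) (λ i → countRow (adj G i) i)

Independent : (G : Graph) → Subset (n G) → Set
Independent G S = ∀ i j → i ∈ S → j ∈ S → adj G i j ≡ false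

IndepNum : Graph → ℕ → Set
IndepNum G a =
  Σ (Subset (n G)) (λ S → Independent G S × ∣ S ∣ ≡ a)
  × (∀ S → Independent G S → ∣ S ∣ ≤ a)

IsMatching : (G : Graph) → List (Fin (n G) × Fin (n G)) → Set
IsMatching G M =
  All (λ e → adj G (proj₁ e) (proj₂ e) ≡ true) M
  × Unique (concatMap (λ e → proj₁ e ∷ proj₂ e ∷ []) M)

MatchNum : Graph → ℕ → Set
MatchNum G m =
  Σ (List (Fin (n G) × Fin (n G))) (λ M → IsMatching G M × length M ≡ m)
  × (∀ M → IsMatching G M → length M ≤ m)

_≅_ : Graph → Graph → Set
G ≅ H = Σ (Fin (n G) ↔ Fin (n H)) λ f →
  ∀ i j → adj G i j ≡ adj H (Inverse.to f i) (Inverse.to f j)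

-- e₁ and E₁:  "e₁(α,ν) = e and E₁(α,ν) = L up to isomorphism"

InE1 : ℕ → ℕ → ℕ → Graph → Set
InE1 α ν e G = IndepNum G α × MatchNum G ν × edges G ≡ e

ExtremalData : ℕ → ℕ → ℕ → List Graph → Set
ExtremalData α ν e L =
  All (InE1 α ν e) L
  × (∀ G → IndepNum G α → MatchNum G ν → edges G ≤ e)
  × (∀ G → InE1 α ν e G → Any (G ≅_) L)

neq : ∀ {k} → Fin k → Fin k → Bool
neq i j = not (does (i ≟ j))

neq-irrefl : ∀ {k} (i : Fin k) → neq i i ≡ false
neq-irrefl i with i ≟ i
... | yes _ = refl
... | no ¬p = ⊥-elim (¬p refl)

neq-sym : ∀ {k} (i j : Fin k) → neq i j ≡ neq j i
neq-sym i j with i ≟ j | j ≟ i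
... | yes _ | yes _ = refl
... | no _  | no _  = refl
... | yes p | no ¬q = ⊥-elim (¬q (Relation.Binary.PropositionalEquality.sym p))
... | no ¬p | yes q = ⊥-elim (¬p (Relation.Binary.PropositionalEquality.sym q))

-- G_{α,ν}: K_{2ν+1} plus α-1 isolated vertices.
-- Vertices 0 .. 2ν form the clique; the remaining α-1 are isolated.
Gαν : ℕ → ℕ → Graph
Gαν α ν = record
  { n = (2 * ν + 1) + (α ∸ 1)
  ; adj = A
  ; sym = λ i j → cong₂ _∧_ (neq-sym i j) (∧-comm (inK i) (inK j))
  ; irrefl = λ i → Relation.Binary.PropositionalEquality.cong (_∧ (inK i ∧ inK i)) (neq-irrefl i)
  }
  where
  N = (2 * ν + 1) + (α ∸ 1)
  inK : Fin N → Bool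
  inK i = does (toℕ i <? (2 * ν + 1))
  A : Fin N → Fin N → Bool
  A i j = neq i j ∧ (inK i ∧ inK j)

-- H_{α,ν}: K_{α,ν} plus all edges inside the part of size ν.
-- Vertices 0 .. α-1 form the independent part, α .. α+ν-1 the clique part.
Hαν : ℕ → ℕ → Graph
Hαν α ν = record
  { n = α + ν
  ; adj = A
  ; sym = λ i j → cong₂ _∧_ (neq-sym i j) (∨-comm (big i) (big j))
  ; irrefl = λ i → Relation.Binary.PropositionalEquality.cong (_∧ (big i ∨ big i)) (neq-irrefl i)
  }
  where
  big : Fin (α + ν) → Bool
  big i = does (α ≤? toℕ i)
  A : Fin (α + ν) → Fin (α + ν) → Bool
  A i j = neq i j ∧ (big i ∨ big j)

{-# OPTIONS --safe #-}
module Submission where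

-- Delete vertices that every maximum matching covers, one at a time, until none
-- is left; this gives a set S such that ν = |S| + k for the matching number k of
-- G ∖ S, in which every vertex is missed by some maximum matching. Fix a maximum
-- matching of G ∖ S, covering X with |X| = 2k and missing U. Then U is
-- independent, so |U| ≤ α, and an alternating path argument (the core of Gallai's
-- lemma) shows that each x ∈ X has at most one neighbour in U. Hence, with s = |S|,
--   |E| ≤ C(s,2) + s (2k + |U|) + C(2k,2) + 2k,
-- which, with |U| replaced by α, is convex in s for fixed s + k = ν: its maximum
-- is at s = 0, where it is C(2ν+1,2), or at k = 0, where it is αν + C(ν,2).
-- Equality at s = 0 forces X and a single common neighbour in U to form a clique;
-- equality at k = 0 forces S to be joined to everything and |U| = α.

open import Defs
import Data.Bool as Bool
open import Data.Bool using (Bool; true; false; not; _∧_; _∨_)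
open import Data.Bool.Properties using (∧-comm; ∧-identityʳ; ∧-zeroʳ)
open import Data.Empty using (⊥; ⊥-elim)
open import Data.Fin using (Fin; zero; suc; toℕ; _≟_)
import Data.Fin.Properties as Fin
open import Data.Fin.Subset using (Subset; ∣_∣; _∈_)
open import Data.List using (List; _∷_; []; length; concatMap; allFin)
open import Data.List.Relation.Unary.All as All using (All; []; _∷_)
open import Data.List.Relation.Unary.AllPairs using ([]; _∷_)
open import Data.List.Relation.Unary.Any using (Any; here; there)
open import Data.List.Relation.Unary.Unique.Propositional using (Unique)
import Data.Nat as ℕ
open import Data.Nat
  using (ℕ; zero; suc; _+_; _*_; _∸_; _≤_; _<_; _>_; z≤n; s≤s; s≤s⁻¹; _<ᵇ_; _≤ᵇ_; _≤?_; _<?_)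
open import Data.Nat.Combinatorics using (_C_; nC1≡n; nCk+nC[k+1]≡[n+1]C[k+1])
open import Data.Nat.Properties hiding (_≟_; ≟-diag)
open import Data.Nat.Tactic.RingSolver using (solve-∀)
open import Data.Product using (Σ; ∃; _×_; _,_; proj₁; proj₂)
import Data.Sum as Sum⊎
open import Data.Sum using (_⊎_; inj₁; inj₂)
open import Data.Vec using (Vec; lookup; tabulate; _∷_; [])
open import Data.Vec.Properties using (lookup∘tabulate; lookup⇒[]=; []=⇒lookup)
open import Function using (_∘_)
open import Function.Bundles using (_↔_; Inverse; mk↔ₛ′)
open import Function.Properties.Inverse using (↔-sym; ↔-trans)
open import Relation.Binary.Definitions using (tri<; tri≈; tri>)
open import Relation.Binary.PropositionalEquality
  using (_≡_; _≢_; refl; cong; cong₂; trans; subst; subst₂; module ≡-Reasoning)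
  renaming (sym to ≡-sym)
open import Relation.Nullary using (Dec; does; yes; no; ¬_)
open import Relation.Nullary.Decidable
  using (dec-true; dec-false; decidable-stable; map′; _×-dec_; _→-dec_; ¬?)
import Algebra.Properties.Semiring.Sum +-*-semiring as Sum

-- Without the deletions, the edges between covered and missed vertices could number on the order of
-- k|U|, a term growing with α. Every vertex with several missed neighbours is essential, however,
-- so S absorbs these: for `Hαν` with ν < α it becomes the whole clique part, while `Gαν` has no
-- essential vertex and leaves S empty. The extremal graphs thus sit at the two ends k = 0 and s =
-- 0. The edge bound is proved entry by entry on the adjacency matrix, so equality of the counts
-- forces equality of all entries, and the extremal graphs are read off the bounding matrix. The
-- counts avoid subtraction and halving: a matching of k edges is measured by exposed + 2k = n, an
-- edge number by 2|E| + n, and the slack in an inequality is a natural number added to its smaller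
-- side.

private variable
  N : ℕ

_==_ : Fin N → Fin N → Bool
i == j = does (i ≟ j)

==-refl : (i : Fin N) → (i == i) ≡ true
==-refl i with i ≟ i
... | yes _ = refl
... | no i≢i = ⊥-elim (i≢i refl)

==-false : {i j : Fin N} → i ≢ j → (i == j) ≡ false
==-false {i = i} {j} i≢j with i ≟ j
... | yes i≡j = ⊥-elim (i≢j i≡j)
... | no _ = refl

==-sound : (i j : Fin N) → (i == j) ≡ true → i ≡ j
==-sound i j eq with i ≟ j
... | yes i≡j = i≡j

true≢false : {b : Bool} → b ≡ true → b ≡ false → ⊥
true≢false refl ()

-- Sums and cardinalities

𝟙 : Bool → ℕ
𝟙 true  = 1
𝟙 false = 0

𝟙≤1 : ∀ b → 𝟙 b ≤ 1
𝟙≤1 true  = ≤-refl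
𝟙≤1 false = z≤n

-- Opaque, so that unification treats sum as injective.
opaque
  sum : (Fin N → ℕ) → ℕ
  sum {N} f = sumFin N f

card : (Fin N → Bool) → ℕ
card P = sum (𝟙 ∘ P)

countList : {A : Set} → (A → Bool) → List A → ℕ
countList P []       = 0
countList P (x ∷ xs) = 𝟙 (P x) + countList P xs

opaque
  unfolding sum

  sum-cong : {f g : Fin N → ℕ} → (∀ i → f i ≡ g i) → sum f ≡ sum g
  sum-cong {zero}  f≡g = refl
  sum-cong {suc N} f≡g = cong₂ _+_ (f≡g zero) (sum-cong (f≡g ∘ suc))

  sum≡sumFin : (f : Fin N → ℕ) → sum f ≡ sumFin N f
  sum≡sumFin f = refl

  sumFin≡Sum : (f : Fin N → ℕ) → sum f ≡ Sum.sum f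
  sumFin≡Sum {zero}  f = refl
  sumFin≡Sum {suc N} f = cong (f zero +_) (sumFin≡Sum (f ∘ suc))

  sum-+ : (f g : Fin N → ℕ) → sum (λ i → f i + g i) ≡ sum f + sum g
  sum-+ f g rewrite sumFin≡Sum (λ i → f i + g i) | sumFin≡Sum f | sumFin≡Sum g =
    Sum.∑-distrib-+ f g

  *-sum : ∀ c (f : Fin N → ℕ) → c * sum f ≡ sum (λ i → c * f i)
  *-sum c f rewrite sumFin≡Sum f | sumFin≡Sum (λ i → c * f i) = Sum.*-distribˡ-sum c f

  sum-* : ∀ c (f : Fin N → ℕ) → sum f * c ≡ sum (λ i → f i * c)
  sum-* c f rewrite sumFin≡Sum f | sumFin≡Sum (λ i → f i * c) = Sum.*-distribʳ-sum c f

  sum-comm : (f : Fin N → Fin N → ℕ) → sum (λ i → sum (f i)) ≡ sum (λ j → sum (λ i → f i j))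
  sum-comm f = begin
    sum (λ i → sum (f i))                  ≡⟨ sum²≡Sum² f ⟩
    Sum.sum (λ i → Sum.sum (f i))          ≡⟨ Sum.∑-comm f ⟩
    Sum.sum (λ j → Sum.sum (λ i → f i j))  ≡⟨ sum²≡Sum² (λ j i → f i j) ⟨
    sum (λ j → sum (λ i → f i j))          ∎
    where
    open ≡-Reasoning
    sum²≡Sum² : (g : Fin N → Fin N → ℕ) → sum (λ i → sum (g i)) ≡ Sum.sum (λ i → Sum.sum (g i))
    sum²≡Sum² g = trans (sum-cong (λ i → sumFin≡Sum (g i))) (sumFin≡Sum (λ i → Sum.sum (g i)))

  sum-mono : {f g : Fin N → ℕ} → (∀ i → f i ≤ g i) → sum f ≤ sum g
  sum-mono {zero}  f≤g = z≤n
  sum-mono {suc N} f≤g = +-mono-≤ (f≤g zero) (sum-mono (f≤g ∘ suc))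

  sum-mono-tight : {f g : Fin N → ℕ} → (∀ i → f i ≤ g i) → sum g ≤ sum f → ∀ i → f i ≡ g i
  sum-mono-tight {suc N} {f} {g} f≤g Σg≤Σf zero = ≤-antisym (f≤g zero)
    (+-cancelʳ-≤ (sum (f ∘ suc)) (g zero) (f zero)
      (≤-trans (+-monoʳ-≤ (g zero) (sum-mono (f≤g ∘ suc))) Σg≤Σf))
  sum-mono-tight {suc N} {f} {g} f≤g Σg≤Σf (suc i) = sum-mono-tight (f≤g ∘ suc)
    (+-cancelˡ-≤ (f zero) _ _ (≤-trans (+-monoˡ-≤ (sum (g ∘ suc)) (f≤g zero)) Σg≤Σf)) i

  sum-zero : ∀ N → sum {N} (λ _ → 0) ≡ 0
  sum-zero zero    = refl
  sum-zero (suc N) = sum-zero N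

  sum-one : ∀ N → sum {N} (λ _ → 1) ≡ N
  sum-one zero    = refl
  sum-one (suc N) = cong suc (sum-one N)

  card-point : (x : Fin N) → card (_== x) ≡ 1
  card-point {suc N} zero    = cong suc (sum-zero N)
  card-point {suc N} (suc x) = card-point x

  card-positive : (P : Fin N → Bool) → 1 ≤ card P → ∃ λ i → P i ≡ true
  card-positive {suc N} P 1≤ with P zero in eq
  ... | true = zero , eq
  ... | false with i , Pi ← card-positive (P ∘ suc) 1≤ = suc i , Pi

  ∣∣≡card : (S : Subset N) → ∣ S ∣ ≡ card (lookup S)
  ∣∣≡card []          = refl
  ∣∣≡card (true ∷ S)  = cong suc (∣∣≡card S)
  ∣∣≡card (false ∷ S) = ∣∣≡card S

  countList-tabulate : {A : Set} (P : A → Bool) (f : Fin N → A) →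
    countList P (Data.List.tabulate f) ≡ card (P ∘ f)
  countList-tabulate {zero}  P f = refl
  countList-tabulate {suc N} P f = cong (𝟙 (P (f zero)) +_) (countList-tabulate P (f ∘ suc))

∑∑ : (Fin N → Fin N → ℕ) → ℕ
∑∑ f = sum (λ i → sum (f i))

card≤ : (P : Fin N → Bool) → card P ≤ N
card≤ {N} P = subst (card P ≤_) (sum-one N) (sum-mono (𝟙≤1 ∘ P))

card-not : (P : Fin N → Bool) → card P + card (not ∘ P) ≡ N
card-not {N} P = trans (≡-sym (sum-+ (𝟙 ∘ P) (𝟙 ∘ not ∘ P)))
  (trans (sum-cong (λ i → 𝟙-not (P i))) (sum-one N))
  where
  𝟙-not : ∀ b → 𝟙 b + 𝟙 (not b) ≡ 1
  𝟙-not true  = refl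
  𝟙-not false = refl

card-remove : (P : Fin N → Bool) (x : Fin N) → P x ≡ true →
  card P ≡ suc (card (λ i → P i ∧ not (i == x)))
card-remove P x Px = trans (sum-cong pointwise)
  (trans (sum-+ (𝟙 ∘ (_== x)) _) (cong (_+ card (λ i → P i ∧ not (i == x))) (card-point x)))
  where
  pointwise : ∀ i → 𝟙 (P i) ≡ 𝟙 (i == x) + 𝟙 (P i ∧ not (i == x))
  pointwise i with i ≟ x | P i in Pi
  ... | yes refl | true  = refl
  ... | yes refl | false = ⊥-elim (true≢false Px Pi)
  ... | no _     | true  = refl
  ... | no _     | false = refl

card-insert : (P : Fin N → Bool) (x : Fin N) → P x ≡ false →
  card (λ i → P i ∨ (i == x)) ≡ suc (card P)
card-insert P x Px = trans (sum-cong pointwise)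
  (trans (sum-+ (𝟙 ∘ (_== x)) _) (cong (_+ card _) (card-point x)))
  where
  pointwise : ∀ i → 𝟙 (P i ∨ (i == x)) ≡ 𝟙 (i == x) + 𝟙 (P i)
  pointwise i with i ≟ x | P i in Pi
  ... | yes refl | true  = ⊥-elim (true≢false Pi Px)
  ... | yes refl | false = refl
  ... | no _     | true  = refl
  ... | no _     | false = refl

∑∑-cong : {f g : Fin N → Fin N → ℕ} → (∀ i j → f i j ≡ g i j) → ∑∑ f ≡ ∑∑ g
∑∑-cong f≡g = sum-cong (λ i → sum-cong (f≡g i))

∑∑-+ : (f g : Fin N → Fin N → ℕ) → ∑∑ (λ i j → f i j + g i j) ≡ ∑∑ f + ∑∑ g
∑∑-+ f g = trans (sum-cong (λ i → sum-+ (f i) (g i)))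
  (sum-+ (λ i → sum (f i)) (λ i → sum (g i)))

∑∑-* : (f g : Fin N → ℕ) → ∑∑ (λ i j → f i * g j) ≡ sum f * sum g
∑∑-* f g = trans (sum-cong (λ i → ≡-sym (*-sum (f i) g)))
  (≡-sym (sum-* (sum g) f))

∑∑-point : (f : Fin N → ℕ) (t : Fin N → Fin N) → ∑∑ (λ i j → f i * 𝟙 (j == t i)) ≡ sum f
∑∑-point f t = sum-cong λ i → begin
  sum (λ j → f i * 𝟙 (j == t i)) ≡⟨ *-sum (f i) (λ j → 𝟙 (j == t i)) ⟨
  f i * card (_== t i)           ≡⟨ cong (f i *_) (card-point (t i)) ⟩
  f i * 1                        ≡⟨ *-identityʳ (f i) ⟩
  f i                            ∎
  where open ≡-Reasoning

∑∑-mono : {f g : Fin N → Fin N → ℕ} → (∀ i j → f i j ≤ g i j) → ∑∑ f ≤ ∑∑ g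
∑∑-mono f≤g = sum-mono (λ i → sum-mono (f≤g i))

∑∑-mono-tight : {f g : Fin N → Fin N → ℕ} → (∀ i j → f i j ≤ g i j) →
  ∑∑ g ≤ ∑∑ f → ∀ i j → f i j ≡ g i j
∑∑-mono-tight f≤g Σg≤Σf i = sum-mono-tight (f≤g i)
  (≤-reflexive (≡-sym (sum-mono-tight (λ i → sum-mono (f≤g i)) Σg≤Σf i)))

-- Edge counts

above : (Fin N → Bool) → Fin N → Fin N → Bool
above f i j = does (toℕ i <? toℕ j) ∧ f j

-- The counting function local to countRow has no name outside Defs; the left
-- side of countRow-step is inferred from its use in countRow-list.
mutual
  countRow-list : (f : Fin N → Bool) (i : Fin N) →
    countRow f i ≡ countList (above f i) (allFin N)
  countRow-list {N} f i with allFin N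
  ... | js = countRow-step f i js

  countRow-step : (f : Fin N → Bool) (i : Fin N) (js : List (Fin N)) →
    _ ≡ countList (above f i) js
  countRow-step f i [] = refl
  countRow-step f i (j ∷ js) with above f i j
  ... | true  = cong suc (countRow-step f i js)
  ... | false = countRow-step f i js

-- Counting closed neighbourhoods turns n (n ∸ 1) into a square, which avoids
-- truncated subtraction.
closedAdj : (G : Graph) → Fin (n G) → Fin (n G) → ℕ
closedAdj G i j = 𝟙 (adj G i j) + 𝟙 (j == i)

2*edges+n : (G : Graph) → 2 * edges G + n G ≡ ∑∑ (closedAdj G)
2*edges+n G = ≡-sym (begin
  ∑∑ (closedAdj G)                ≡⟨ ∑∑-+ _ _ ⟩
  ∑∑ (λ i j → 𝟙 (adj G i j)) + ∑∑ {n G} (λ i j → 𝟙 (j == i))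
    ≡⟨ cong₂ _+_ (trans (∑∑-cong split) (∑∑-+ _ _)) diagonal ⟩
  (∑∑ up + ∑∑ (λ i j → up j i)) + n G
    ≡⟨ cong (λ z → (∑∑ up + z) + n G) (sum-comm (λ i j → up j i)) ⟩
  (∑∑ up + ∑∑ up) + n G
    ≡⟨ cong (λ z → (z + z) + n G) (≡-sym edges≡up) ⟩
  (edges G + edges G) + n G       ≡⟨ cong (λ z → (edges G + z) + n G) (+-identityʳ (edges G)) ⟨
  2 * edges G + n G               ∎)
  where
  open ≡-Reasoning
  up : Fin (n G) → Fin (n G) → ℕ
  up i j = 𝟙 (above (adj G i) i j)
  edges≡up : edges G ≡ ∑∑ up
  edges≡up = trans (≡-sym (sum≡sumFin _)) (sum-cong λ i →
    trans (countRow-list (adj G i) i) (countList-tabulate (above (adj G i) i) (λ j → j)))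
  diagonal : ∑∑ {n G} (λ i j → 𝟙 (j == i)) ≡ n G
  diagonal = trans (sum-cong card-point) (sum-one (n G))
  split : ∀ i j → 𝟙 (adj G i j) ≡ up i j + up j i
  split i j rewrite Graph.sym G j i with <-cmp (toℕ i) (toℕ j)
  ... | tri< i<j _ i≯j rewrite dec-true (toℕ i <? toℕ j) i<j | dec-false (toℕ j <? toℕ i) i≯j =
    ≡-sym (+-identityʳ _)
  ... | tri> i≮j _ i>j rewrite dec-false (toℕ i <? toℕ j) i≮j | dec-true (toℕ j <? toℕ i) i>j =
    refl
  ... | tri≈ _ i≡j _ rewrite Fin.toℕ-injective i≡j | irrefl G j | ∧-zeroʳ (toℕ j <ᵇ toℕ j) = refl

-- Matchings

-- A matching is encoded by its mate function: an involution fixing exactly the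
-- vertices the matching misses.
Mate : (G : Graph) → (Fin (n G) → Fin (n G)) → Set
Mate G m = (∀ v → m (m v) ≡ v) × (∀ v → m v ≢ v → adj G v (m v) ≡ true)

exposed : (Fin N → Fin N) → ℕ
exposed m = card (λ v → m v == v)

update₂ : (x a y b : Fin N) → (Fin N → Fin N) → Fin N → Fin N
update₂ x a y b m v with v ≟ x | v ≟ y
... | yes _ | _     = a
... | no _  | yes _ = b
... | no _  | no _  = m v

update₂-fst : (x a y b : Fin N) (m : Fin N → Fin N) → update₂ x a y b m x ≡ a
update₂-fst x a y b m with x ≟ x | x ≟ y
... | yes _  | _ = refl
... | no x≢x | _ = ⊥-elim (x≢x refl)

update₂-snd : (x a y b : Fin N) (m : Fin N → Fin N) → x ≢ y → update₂ x a y b m y ≡ b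
update₂-snd x a y b m x≢y with y ≟ x | y ≟ y
... | yes y≡x | _      = ⊥-elim (x≢y (≡-sym y≡x))
... | no _    | yes _  = refl
... | no _    | no y≢y = ⊥-elim (y≢y refl)

update₂-other : (x a y b : Fin N) (m : Fin N → Fin N) (v : Fin N) → v ≢ x → v ≢ y →
  update₂ x a y b m v ≡ m v
update₂-other x a y b m v v≢x v≢y with v ≟ x | v ≟ y
... | yes v≡x | _       = ⊥-elim (v≢x v≡x)
... | no _    | yes v≡y = ⊥-elim (v≢y v≡y)
... | no _    | no _    = refl

-- One count for both directions: `m` is the matching before the edge `x`-`y` is added, or the one
-- left after it is deleted.
exposed-drop : (m m′ : Fin N → Fin N) (x y : Fin N) → x ≢ y →
  m x ≡ x → m y ≡ y → m′ x ≢ x → m′ y ≢ y →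
  (∀ v → v ≢ x → v ≢ y → m′ v ≡ m v) → exposed m ≡ 2 + exposed m′
exposed-drop m m′ x y x≢y mx my m′x m′y off = begin
  exposed m
    ≡⟨ sum-cong pointwise ⟩
  sum (λ v → 𝟙 (v == x) + (𝟙 (v == y) + 𝟙 (m′ v == v)))
    ≡⟨ sum-+ (λ v → 𝟙 (v == x)) (λ v → 𝟙 (v == y) + 𝟙 (m′ v == v)) ⟩
  card (_== x) + sum (λ v → 𝟙 (v == y) + 𝟙 (m′ v == v))
    ≡⟨ cong₂ _+_ (card-point x) (sum-+ (λ v → 𝟙 (v == y)) (λ v → 𝟙 (m′ v == v))) ⟩
  1 + (card (_== y) + exposed m′)
    ≡⟨ cong (λ c → 1 + (c + exposed m′)) (card-point y) ⟩
  2 + exposed m′ ∎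
  where
  open ≡-Reasoning
  pointwise : ∀ v → 𝟙 (m v == v) ≡ 𝟙 (v == x) + (𝟙 (v == y) + 𝟙 (m′ v == v))
  pointwise v with v ≟ x | v ≟ y
  ... | yes refl | yes refl = ⊥-elim (x≢y refl)
  ... | yes refl | no _ rewrite dec-true (m x ≟ x) mx | dec-false (m′ x ≟ x) m′x = refl
  ... | no _ | yes refl rewrite dec-true (m y ≟ y) my | dec-false (m′ y ≟ y) m′y = refl
  ... | no v≢x | no v≢y rewrite off v v≢x v≢y = refl

adj⇒≢ : (G : Graph) {x y : Fin (n G)} → adj G x y ≡ true → x ≢ y
adj⇒≢ G {x} xy refl = true≢false xy (irrefl G x)

mate-moved : {m : Fin N → Fin N} → (∀ v → m (m v) ≡ v) → ∀ {v} → m v ≢ v → m (m v) ≢ m v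
mate-moved inv {v} mv≢v eq = mv≢v (trans (≡-sym eq) (inv v))

record AddEdge (G : Graph) (m : Fin (n G) → Fin (n G)) (x y : Fin (n G)) : Set where
  field
    mate  : Fin (n G) → Fin (n G)
    valid : Mate G mate
    at-x  : mate x ≡ y
    at-y  : mate y ≡ x
    other : ∀ v → v ≢ x → v ≢ y → mate v ≡ m v
    count : exposed m ≡ 2 + exposed mate

record DelEdge (G : Graph) (m : Fin (n G) → Fin (n G)) (x : Fin (n G)) : Set where
  field
    mate  : Fin (n G) → Fin (n G)
    valid : Mate G mate
    at-x  : mate x ≡ x
    at-y  : mate (m x) ≡ m x
    other : ∀ v → v ≢ x → v ≢ m x → mate v ≡ m v
    count : exposed mate ≡ 2 + exposed m

addEdge : (G : Graph) (m : Fin (n G) → Fin (n G)) (x y : Fin (n G)) → Mate G m →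
  m x ≡ x → m y ≡ y → adj G x y ≡ true → AddEdge G m x y
addEdge G m x y (inv , edge) mx my xy = record
  { mate = m′ ; valid = inv′ , edge′ ; at-x = m′x ; at-y = m′y ; other = off
  ; count = exposed-drop m m′ x y x≢y mx my
      (λ eq → x≢y (trans (≡-sym eq) m′x)) (λ eq → x≢y (trans (≡-sym m′y) eq)) off }
  where
  x≢y = adj⇒≢ G xy
  m′ = update₂ x y y x m
  m′x : m′ x ≡ y
  m′x = update₂-fst x y y x m
  m′y : m′ y ≡ x
  m′y = update₂-snd x y y x m x≢y
  off : ∀ v → v ≢ x → v ≢ y → m′ v ≡ m v
  off = update₂-other x y y x m
  avoid : ∀ {u v} → m u ≡ u → v ≢ u → m v ≢ u
  avoid {u} {v} mu v≢u eq = v≢u (trans (≡-sym (inv v)) (trans (cong m eq) mu))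
  inv′ : ∀ v → m′ (m′ v) ≡ v
  inv′ v with v ≟ x | v ≟ y
  ... | yes refl | _        = m′y
  ... | no _     | yes refl = m′x
  ... | no v≢x   | no v≢y   = trans (off (m v) (avoid mx v≢x) (avoid my v≢y)) (inv v)
  edge′ : ∀ v → m′ v ≢ v → adj G v (m′ v) ≡ true
  edge′ v moved with v ≟ x | v ≟ y
  ... | yes refl | _        = xy
  ... | no _     | yes refl = trans (Graph.sym G y x) xy
  ... | no v≢x   | no v≢y   = edge v moved

delEdge : (G : Graph) (m : Fin (n G) → Fin (n G)) (x : Fin (n G)) → Mate G m →
  m x ≢ x → DelEdge G m x
delEdge G m x (inv , edge) mx≢x = record
  { mate = m′ ; valid = inv′ , edge′ ; at-x = m′x ; at-y = m′y ; other = off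
  ; count = exposed-drop m′ m x y x≢y m′x m′y mx≢x (mate-moved {m = m} inv mx≢x)
      (λ v v≢x v≢y → ≡-sym (off v v≢x v≢y)) }
  where
  y = m x
  x≢y : x ≢ y
  x≢y eq = mx≢x (≡-sym eq)
  m′ = update₂ x x y y m
  m′x : m′ x ≡ x
  m′x = update₂-fst x x y y m
  m′y : m′ y ≡ y
  m′y = update₂-snd x x y y m x≢y
  off : ∀ v → v ≢ x → v ≢ y → m′ v ≡ m v
  off = update₂-other x x y y m
  inv′ : ∀ v → m′ (m′ v) ≡ v
  inv′ v with v ≟ x | v ≟ y
  ... | yes refl | _        = m′x
  ... | no _     | yes refl = m′y
  ... | no v≢x   | no v≢y   = trans (off (m v)
    (λ mv≡x → v≢y (trans (≡-sym (inv v)) (cong m mv≡x)))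
    (λ mv≡y → v≢x (trans (≡-sym (inv v)) (trans (cong m mv≡y) (inv x))))) (inv v)
  edge′ : ∀ v → m′ v ≢ v → adj G v (m′ v) ≡ true
  edge′ v moved with v ≟ x | v ≟ y
  ... | yes refl | _        = ⊥-elim (moved refl)
  ... | no _     | yes refl = ⊥-elim (moved refl)
  ... | no v≢x   | no v≢y   = edge v moved

endpoints : {A : Set} → List (A × A) → List A
endpoints = concatMap (λ e → proj₁ e ∷ proj₂ e ∷ [])

exposed-id : (m : Fin N → Fin N) → (∀ v → m v ≡ v) → exposed m ≡ N
exposed-id {N} m fixed =
  trans (sum-cong (λ v → cong 𝟙 (dec-true (m v ≟ v) (fixed v)))) (sum-one N)

+-2*suc : ∀ a l → 2 + a + 2 * l ≡ a + 2 * suc l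
+-2*suc a l = begin
  2 + a + 2 * l     ≡⟨ cong (_+ 2 * l) (+-comm 2 a) ⟩
  a + 2 + 2 * l     ≡⟨ +-assoc a 2 (2 * l) ⟩
  a + (2 + 2 * l)   ≡⟨ cong (a +_) (*-suc 2 l) ⟨
  a + 2 * suc l     ∎
  where open ≡-Reasoning

-- The last component drives the induction: by `Unique` the ends of the next edge are off the other
-- edges, hence still exposed when that edge is added.
fromList : (G : Graph) (M : List (Fin (n G) × Fin (n G))) → IsMatching G M →
  ∃ λ m → Mate G m × exposed m + 2 * length M ≡ n G
        × (∀ v → All (v ≢_) (endpoints M) → m v ≡ v)
fromList G [] _ = (λ v → v) , ((λ _ → refl) , (λ v v≢v → ⊥-elim (v≢v refl)))
  , trans (+-identityʳ _) (exposed-id (λ v → v) (λ _ → refl)) , (λ _ _ → refl)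
fromList G ((x , y) ∷ M) (xy ∷ adjs , ((x≢y ∷ x∉) ∷ (y∉ ∷ unique)))
  with m , valid , size , fixed ← fromList G M (adjs , unique) =
  A.mate , A.valid
  , trans (≡-sym (+-2*suc (exposed A.mate) (length M)))
      (trans (cong (_+ 2 * length M) (≡-sym A.count)) size)
  , (λ { v (v≢x ∷ v≢y ∷ v∉) → trans (A.other v v≢x v≢y) (fixed v v∉) })
  where module A = AddEdge (addEdge G m x y valid (fixed x x∉) (fixed y y∉) xy)

EdgesOf : (G : Graph) → (Fin (n G) → Fin (n G)) → Set
EdgesOf G m = ∃ λ M → IsMatching G M × exposed m + 2 * length M ≡ n G
                    × (∀ v → m v ≡ v → All (v ≢_) (endpoints M))

toList : (G : Graph) (m : Fin (n G) → Fin (n G)) → Mate G m → EdgesOf G m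
toList G m valid = go (n G) m valid (m≤n+m (n G) (exposed m))
  where
  -- Each deletion exposes two more vertices and at most `n G` can be exposed, so the fuel cannot
  -- run out while an edge remains.
  go : ∀ fuel m → Mate G m → n G ≤ exposed m + fuel → EdgesOf G m
  go fuel m valid enough with Fin.any? (λ v → ¬? (m v ≟ v))
  ... | no none = [] , ([] , [])
    , trans (+-identityʳ _) (exposed-id m (λ v → decidable-stable (m v ≟ v) (λ mv≢v → none (v , mv≢v))))
    , (λ _ _ → [])
  go zero m valid enough | yes (x , mx≢x) = ⊥-elim (<-irrefl refl (begin-strict
    exposed m      <⟨ s≤s (n≤1+n (exposed m)) ⟩
    2 + exposed m  ≡⟨ D.count ⟨
    exposed D.mate ≤⟨ card≤ _ ⟩
    n G            ≤⟨ enough ⟩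
    exposed m + 0  ≡⟨ +-identityʳ _ ⟩
    exposed m      ∎))
    where
    open ≤-Reasoning
    module D = DelEdge (delEdge G m x valid mx≢x)
  go (suc fuel) m valid@(inv , edge) enough | yes (x , mx≢x) = cons (go fuel D.mate D.valid enough′)
    where
    module D = DelEdge (delEdge G m x valid mx≢x)
    enough′ : n G ≤ exposed D.mate + fuel
    enough′ rewrite D.count = ≤-trans enough
      (≤-trans (≤-reflexive (+-suc (exposed m) fuel)) (n≤1+n _))
    cons : EdgesOf G D.mate → EdgesOf G m
    cons (M , (adjs , unique) , size , avoid) =
      (x , m x) ∷ M
      , ((edge x mx≢x ∷ adjs)
        , (((λ eq → mx≢x (≡-sym eq)) ∷ avoid x D.at-x) ∷ (avoid (m x) D.at-y ∷ unique)))
      , trans (≡-sym (+-2*suc (exposed m) (length M)))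
          (trans (cong (_+ 2 * length M) (≡-sym D.count)) size)
      , (λ v mv → let v≢x = λ { refl → mx≢x mv } ; v≢mx = λ { refl → mate-moved {m = m} inv mx≢x mv } in
          v≢x ∷ v≢mx ∷ avoid v (trans (D.other v v≢x v≢mx) mv))

-- k is the number of matching edges: twice k vertices are covered.
Optimal : (G : Graph) → ℕ → (Fin (n G) → Fin (n G)) → Set
Optimal G k m = Mate G m × exposed m + 2 * k ≡ n G

-- `Optimal` alone only fixes the size of a matching; together with `Bounded` it makes `k` the
-- matching number of `G`.
Bounded : Graph → ℕ → Set
Bounded G k = ∀ m → Mate G m → n G ≤ exposed m + 2 * k

nonaugmentable : (G : Graph) (k : ℕ) → Bounded G k → ∀ {m x y} → Optimal G k m →
  m x ≡ x → m y ≡ y → adj G x y ≡ true → ⊥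
nonaugmentable G k bounded {m} {x} {y} (valid , size) mx my xy =
  <-irrefl refl (begin-strict
    n G                        ≤⟨ bounded A.mate A.valid ⟩
    exposed A.mate + 2 * k     <⟨ s≤s (n≤1+n _) ⟩
    2 + exposed A.mate + 2 * k ≡⟨ cong (_+ 2 * k) A.count ⟨
    exposed m + 2 * k          ≡⟨ size ⟩
    n G                        ∎)
  where
  open ≤-Reasoning
  module A = AddEdge (addEdge G m x y valid mx my xy)

-- The edge `x`-`m x` is swapped for `m x`-`z`. The size stays and the missed vertex moves from `z`
-- to `x`: a step of two edges along an alternating path.
record Rotation (G : Graph) (k : ℕ) (m : Fin (n G) → Fin (n G)) (x z : Fin (n G)) : Set where
  field
    mate    : Fin (n G) → Fin (n G)
    optimal : Optimal G k mate
    at-x    : mate x ≡ x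
    at-y    : mate (m x) ≡ z
    at-z    : mate z ≡ m x
    other   : ∀ v → v ≢ x → v ≢ m x → v ≢ z → mate v ≡ m v

rotate : (G : Graph) (k : ℕ) (m : Fin (n G) → Fin (n G)) (x z : Fin (n G)) → Optimal G k m →
  m x ≢ x → m z ≡ z → adj G (m x) z ≡ true → Rotation G k m x z
rotate G k m x z (valid@(inv , edge) , size) mx≢x mz yz = record
  { mate = A.mate
  ; optimal = A.valid , trans (cong (_+ 2 * k) (suc-injective (suc-injective
      (trans (≡-sym A.count) D.count)))) size
  ; at-x = trans (A.other x (λ eq → mx≢x (≡-sym eq)) (λ eq → z≢x (≡-sym eq))) D.at-x
  ; at-y = A.at-x
  ; at-z = A.at-y
  ; other = λ v v≢x v≢y v≢z → trans (A.other v v≢y v≢z) (D.other v v≢x v≢y)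
  }
  where
  module D = DelEdge (delEdge G m x valid mx≢x)
  z≢x : z ≢ x
  z≢x refl = mx≢x mz
  z≢y : z ≢ m x
  z≢y refl = mate-moved {m = m} inv mx≢x mz
  module A = AddEdge (addEdge G D.mate (m x) z D.valid D.at-y
    (trans (D.other z z≢x z≢y) mz) yz)

-- Gallai's exchange argument

disagreement : (m m′ : Fin N → Fin N) → ℕ
disagreement m m′ = card (λ v → neq (m v) (m′ v))

-- Termination of `exchange`: a rotation of `m′` that gains agreement with `m` at one vertex and
-- loses none brings the two matchings closer.
disagreement-drop : (m m′ m″ : Fin N → Fin N) (x : Fin N) → m x ≢ m′ x → m x ≡ m″ x →
  (∀ v → m v ≡ m′ v → m v ≡ m″ v) → disagreement m m″ < disagreement m m′
disagreement-drop m m′ m″ x differ agree keep = begin-strict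
  disagreement m m″                   <⟨ ≤-refl ⟩
  1 + disagreement m m″               ≡⟨ cong (_+ disagreement m m″) (card-point x) ⟨
  card (_== x) + disagreement m m″    ≡⟨ sum-+ (𝟙 ∘ (_== x)) (λ v → 𝟙 (neq (m v) (m″ v))) ⟨
  sum (λ v → 𝟙 (v == x) + 𝟙 (neq (m v) (m″ v))) ≤⟨ sum-mono pointwise ⟩
  disagreement m m′ ∎
  where
  open ≤-Reasoning
  pointwise : ∀ v → 𝟙 (v == x) + 𝟙 (neq (m v) (m″ v)) ≤ 𝟙 (neq (m v) (m′ v))
  pointwise v with v ≟ x
  ... | yes refl rewrite dec-false (m v ≟ m′ v) differ | dec-true (m v ≟ m″ v) agree = ≤-refl
  ... | no _ with m v ≟ m′ v
  ...   | yes eq rewrite dec-true (m v ≟ m″ v) (keep v eq) = z≤n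
  ...   | no _ = 𝟙≤1 _

-- `end` is the far end of the alternating path, the only vertex missed by `m` that may become
-- covered. `common` serves the recursion: where `m` and `m′` agree, the path does not pass.
record Exchange (G : Graph) (k : ℕ) (m m′ : Fin (n G) → Fin (n G)) (x : Fin (n G)) : Set where
  field
    mate    : Fin (n G) → Fin (n G)
    optimal : Optimal G k mate
    at-x    : mate x ≡ x
    end     : Fin (n G)
    missed  : ∀ v → m v ≡ v → v ≢ end → mate v ≡ v
    common  : ∀ v → m v ≡ m′ v → mate v ≡ m v

-- Follows the alternating path of m and m′ from x two edges at a time: moving
-- the edge of m′ at m x onto x makes m and m′ agree at x.
exchange : (G : Graph) (k : ℕ) → Bounded G k → ∀ d m m′ x → disagreement m m′ ≤ d →
  Optimal G k m → Optimal G k m′ → m x ≢ x → m′ x ≡ x → Exchange G k m m′ x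
exchange G k bounded d m m′ x d≥ opt@((inv , edge) , size) opt′@((inv′ , edge′) , size′) mx≢x m′x
  = byCase (m z ≟ z) d d≥
  where
  y = m x
  z = m′ y
  m′y≢y : m′ y ≢ y
  m′y≢y m′y = nonaugmentable G k bounded opt′ m′x m′y (edge x mx≢x)
  m′z : m′ z ≡ y
  m′z = inv′ y
  y≢z : y ≢ z
  y≢z y≡z = m′y≢y (≡-sym y≡z)
  z≢x : z ≢ x
  z≢x z≡x = mx≢x (trans (≡-sym (trans (cong m′ (≡-sym z≡x)) m′z)) m′x)
  yz : adj G y z ≡ true
  yz = edge′ y m′y≢y
  my : m y ≡ x
  my = inv x
  -- The two matchings differ at each of `x`, `y` and `z`, so neither rotation touches a vertex
  -- where they agree.
  off-common : ∀ {v} → m v ≡ m′ v → v ≢ x × v ≢ y × v ≢ z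
  off-common {v} eq =
      (λ v≡x → mx≢x (trans (trans (cong m (≡-sym v≡x)) eq) (trans (cong m′ v≡x) m′x)))
    , (λ v≡y → z≢x (trans (cong m′ (≡-sym v≡y)) (trans (≡-sym eq) (trans (cong m v≡y) my))))
    , (λ v≡z → z≢x (trans (≡-sym v≡z) (trans (≡-sym (inv v))
        (trans (cong m (trans eq (trans (cong m′ v≡z) m′z))) my))))
  byCase : Dec (m z ≡ z) → ∀ d → disagreement m m′ ≤ d → Exchange G k m m′ x
  byCase (yes mz) _ _ = record
    { mate = R.mate ; optimal = R.optimal ; at-x = R.at-x ; end = z
    ; missed = λ v mv v≢z → trans (R.other v (λ { refl → mx≢x mv })
        (λ { refl → mate-moved {m = m} inv mx≢x mv }) v≢z) mv
    ; common = λ v eq → let v≢x , v≢y , v≢z = off-common eq in R.other v v≢x v≢y v≢z }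
    where module R = Rotation (rotate G k m x z opt mx≢x mz yz)
  byCase (no mz≢z) d d≥ = continue d (≤-trans closer d≥)
    where
    -- Here `m′` gives up `y`-`z` for `x`-`y`, which is an edge of `m`, and misses `z` in place of
    -- `x`; the remaining path starts at `z`.
    module R′ = Rotation (rotate G k m′ z x opt′
      (λ m′z≡z → y≢z (trans (≡-sym m′z) m′z≡z)) m′x
      (trans (cong (λ w → adj G w x) m′z) (trans (Graph.sym G y x) (edge x mx≢x))))
    at-y : R′.mate y ≡ x
    at-y = trans (cong R′.mate (≡-sym m′z)) R′.at-y
    at-x : R′.mate x ≡ y
    at-x = trans R′.at-z m′z
    keep : ∀ v → m v ≡ m′ v → m v ≡ R′.mate v
    keep v eq = let v≢x , v≢y , v≢z = off-common eq in
      trans eq (≡-sym (R′.other v v≢z (λ v≡ → v≢y (trans v≡ m′z)) v≢x))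
    closer : disagreement m R′.mate < disagreement m m′
    closer = disagreement-drop m m′ R′.mate x (λ eq → mx≢x (trans eq m′x)) (≡-sym at-x) keep
    continue : ∀ d → disagreement m R′.mate < d → Exchange G k m m′ x
    continue (suc d) (s≤s d≥) = record
      { mate = R.mate ; optimal = R.optimal ; at-x = R.at-x ; end = E.end
      ; missed = λ v mv v≢end → trans (R.other v (λ { refl → mx≢x mv })
          (λ v≡ → mate-moved {m = m} inv mx≢x (trans (cong m (≡-sym (trans v≡ mate-x)))
            (trans mv (trans v≡ mate-x))))
          (λ { refl → mz≢z mv })) (E.missed v mv v≢end)
      ; common = λ v eq → let v≢x , v≢y , v≢z = off-common eq in
          trans (R.other v v≢x (λ v≡ → v≢y (trans v≡ mate-x)) v≢z) (E.common v (keep v eq)) }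
      where
      module E = Exchange (exchange G k bounded d m R′.mate z d≥ opt R′.optimal mz≢z R′.at-x)
      -- The recursive call keeps the edge `x`-`y`, now shared by both matchings. As it also frees
      -- `z`, that edge can be swapped for `y`-`z`, which frees `x`.
      mate-x : E.mate x ≡ y
      mate-x = E.common x (≡-sym at-x)
      module R = Rotation (rotate G k E.mate x z E.optimal
        (λ eq → mx≢x (trans (≡-sym mate-x) eq)) E.at-x
        (trans (cong (λ w → adj G w z) mate-x) yz))

Inessential : Graph → ℕ → Set
Inessential G k = ∀ v → ∃ λ m → Optimal G k m × m v ≡ v

-- Some maximum matching misses `x`, and exchanging towards it gives one that misses `x` together
-- with all vertices missed by `m` except perhaps one. Of two different neighbours `u` and `u′` at
-- least one therefore stays missed, and its edge to `x` augments.
missedNeighbourUnique : (G : Graph) (k : ℕ) → Bounded G k → Inessential G k →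
  ∀ {m x u u′} → Optimal G k m → m u ≡ u → m u′ ≡ u′ →
  adj G x u ≡ true → adj G x u′ ≡ true → u ≡ u′
missedNeighbourUnique G k bounded inessential {m} {x} {u} {u′} opt mu mu′ xu xu′
  with u ≟ u′ | m x ≟ x
... | yes u≡u′ | _ = u≡u′
... | no _ | yes mx = ⊥-elim (nonaugmentable G k bounded opt mx mu xu)
... | no u≢u′ | no mx≢x
  with m′ , opt′ , m′x ← inessential x = ⊥-elim contra
  where
  module E = Exchange (exchange G k bounded _ m m′ x ≤-refl opt opt′ mx≢x m′x)
  contra : ⊥
  contra with u ≟ E.end
  ... | yes refl = nonaugmentable G k bounded E.optimal E.at-x
    (E.missed u′ mu′ (λ eq → u≢u′ (≡-sym eq))) xu′
  ... | no u≢end = nonaugmentable G k bounded E.optimal E.at-x (E.missed u mu u≢end) xu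

-- Deleting essential vertices

-- Deleted vertices stay behind as isolated ones, so mate functions need no reindexing; in return
-- every matching of `G ∖ S` counts them as exposed.
_∖_ : (G : Graph) → (Fin (n G) → Bool) → Graph
G ∖ S = record
  { n      = n G
  ; adj    = λ i j → adj G i j ∧ (not (S i) ∧ not (S j))
  ; sym    = λ i j → cong₂ _∧_ (Graph.sym G i j) (∧-comm (not (S i)) (not (S j)))
  ; irrefl = λ i → cong (_∧ (not (S i) ∧ not (S i))) (irrefl G i)
  }

∖-adj : (G : Graph) (S : Fin (n G) → Bool) {i j : Fin (n G)} →
  adj G i j ≡ true → S i ≡ false → S j ≡ false → adj (G ∖ S) i j ≡ true
∖-adj G S ij Si Sj rewrite ij | Si | Sj = refl

∖-adj⁻¹ : (G : Graph) (S : Fin (n G) → Bool) {i j : Fin (n G)} →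
  adj (G ∖ S) i j ≡ true → adj G i j ≡ true × S i ≡ false × S j ≡ false
∖-adj⁻¹ G S {i} {j} eq with adj G i j | S i | S j
... | true | false | false = refl , refl , refl

insert : (Fin N → Bool) → Fin N → Fin N → Bool
insert S v i = S i ∨ (i == v)

insert-other : (S : Fin N → Bool) {v i : Fin N} → S i ≡ false → i ≢ v → insert S v i ≡ false
insert-other S Si i≢v rewrite Si = ==-false i≢v

insert-false : (S : Fin N → Bool) {v i : Fin N} → insert S v i ≡ false → S i ≡ false × i ≢ v
insert-false S {v} {i} eq with S i | i ≟ v
... | false | no i≢v = refl , i≢v

module _ (G : Graph) (S : Fin (n G) → Bool) where

  deleted⇒exposed : ∀ {m} → Mate (G ∖ S) m → ∀ {v} → S v ≡ true → m v ≡ v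
  deleted⇒exposed {m} (_ , edge) {v} Sv = decidable-stable (m v ≟ v) λ mv≢v →
    true≢false Sv (proj₁ (proj₂ (∖-adj⁻¹ G S (edge v mv≢v))))

  mate-insert : ∀ {m v} → Mate (G ∖ S) m → m v ≡ v → Mate (G ∖ insert S v) m
  mate-insert {m} {v} (inv , edge) mv = inv , λ w mw≢w →
    let ww , Sw , Smw = ∖-adj⁻¹ G S (edge w mw≢w)
        w≢v = λ w≡v → mw≢w (trans (cong m w≡v) (trans mv (≡-sym w≡v)))
        mw≢v = λ mw≡v → w≢v (trans (≡-sym (inv w)) (trans (cong m mw≡v) mv))
    in ∖-adj G (insert S v) ww (insert-other S Sw w≢v) (insert-other S Smw mw≢v)

  mate-insert⁻¹ : ∀ {m v} → Mate (G ∖ insert S v) m → Mate (G ∖ S) m × m v ≡ v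
  mate-insert⁻¹ {m} {v} (inv , edge) = (inv , λ w mw≢w →
      let ww , Sw , Smw = ∖-adj⁻¹ G (insert S v) (edge w mw≢w)
      in ∖-adj G S ww (proj₁ (insert-false S Sw)) (proj₁ (insert-false S Smw)))
    , decidable-stable (m v ≟ v) λ mv≢v →
        proj₂ (insert-false S (proj₁ (proj₂ (∖-adj⁻¹ G (insert S v) (edge v mv≢v))))) refl

anyVec? : ∀ {l} {P : Vec (Fin N) l → Set} → (∀ w → Dec (P w)) → Dec (∃ P)
anyVec? {l = zero} P? = map′ ([] ,_) (λ { ([] , p) → p }) (P? [])
anyVec? {l = suc l} P? = map′ (λ { (x , w , p) → (x ∷ w) , p }) (λ { (x ∷ w , p) → x , w , p })
  (Fin.any? λ x → anyVec? λ w → P? (x ∷ w))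

mate? : (G : Graph) (m : Fin (n G) → Fin (n G)) → Dec (Mate G m)
mate? G m = Fin.all? (λ v → m (m v) ≟ v)
  ×-dec Fin.all? (λ v → ¬? (m v ≟ v) →-dec (adj G v (m v) Bool.≟ true))

-- An essential vertex has to be found constructively, by a search through all mate functions. These
-- are enumerated as vectors; a function agrees with its table only pointwise, so its properties are
-- carried over one by one.
optimalMissing? : (G : Graph) (k : ℕ) (v : Fin (n G)) → Dec (∃ λ m → Optimal G k m × m v ≡ v)
optimalMissing? G k v = map′ (λ { (w , p) → lookup w , p }) tabulated
  (anyVec? λ w → (mate? G (lookup w) ×-dec (exposed (lookup w) + 2 * k ℕ.≟ n G)) ×-dec (lookup w v ≟ v))
  where
  tabulated : (∃ λ m → Optimal G k m × m v ≡ v) →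
    ∃ λ w → Optimal G k (lookup w) × lookup w v ≡ v
  tabulated (m , ((inv , edge) , size) , mv) = w
    , ((inv′ , edge′) , trans (cong (_+ 2 * k) (sum-cong λ i → cong (λ j → 𝟙 (j == i)) (w≗m i))) size)
    , trans (w≗m v) mv
    where
    w = tabulate m
    w≗m : ∀ i → lookup w i ≡ m i
    w≗m = lookup∘tabulate m
    inv′ : ∀ i → lookup w (lookup w i) ≡ i
    inv′ i = trans (cong (lookup w) (w≗m i)) (trans (w≗m (m i)) (inv i))
    edge′ : ∀ i → lookup w i ≢ i → adj G i (lookup w i) ≡ true
    edge′ i moved = trans (cong (adj G i) (w≗m i)) (edge i (λ eq → moved (trans (w≗m i) eq)))

record Reduced (G : Graph) (ν : ℕ) : Set where
  field
    S           : Fin (n G) → Bool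
    k           : ℕ
    size        : card S + k ≡ ν
    mate        : Fin (n G) → Fin (n G)
    optimal     : Optimal (G ∖ S) k mate
    bounded     : Bounded (G ∖ S) k
    inessential : Inessential (G ∖ S) k

-- If every matching with `k` edges covers `v`, then those avoiding `v` have at most `k - 1`, and
-- dropping the edge at `v` attains this. Moving `v` into `S` thus lowers the matching number by
-- exactly one and preserves `card S + k`; the recursion is on `k`.
reduce : (G : Graph) (k : ℕ) (S : Fin (n G) → Bool) (m : Fin (n G) → Fin (n G)) →
  Optimal (G ∖ S) k m → Bounded (G ∖ S) k → Reduced G (card S + k)
reduce G k S m opt bounded with Fin.all? (optimalMissing? (G ∖ S) k)
... | yes inessential = record
  { S = S ; k = k ; size = refl ; mate = m ; optimal = opt ; bounded = bounded
  ; inessential = inessential }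
... | no ¬inessential = go k refl
  where
  found = Fin.¬∀⟶∃¬ (n G) _ (optimalMissing? (G ∖ S) k) ¬inessential
  v = proj₁ found
  essential : ∀ {m} → Optimal (G ∖ S) k m → m v ≢ v
  essential opt mv = proj₂ found (_ , opt , mv)
  module D = DelEdge (delEdge (G ∖ S) m v (proj₁ opt) (essential opt))
  Sv : S v ≡ false
  Sv with S v in eq
  ... | false = refl
  ... | true  = ⊥-elim (essential opt (deleted⇒exposed G S (proj₁ opt) eq))
  go : ∀ k′ → k ≡ k′ → Reduced G (card S + k)
  -- For `k = 0` all vertices are exposed, yet the essential `v` is covered.
  go zero refl = ⊥-elim (<-irrefl refl (begin-strict
    n G            ≡⟨ proj₂ opt ⟨
    exposed m + 0  ≡⟨ +-identityʳ _ ⟩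
    exposed m      <⟨ s≤s (n≤1+n (exposed m)) ⟩
    2 + exposed m  ≡⟨ D.count ⟨
    exposed D.mate ≤⟨ card≤ _ ⟩
    n G            ∎))
    where open ≤-Reasoning
  go (suc k′) refl = subst (Reduced G) grow (reduce G k′ (insert S v) D.mate
    ( mate-insert G S D.valid D.at-x
    , trans (cong (_+ 2 * k′) D.count) (trans (+-2*suc (exposed m) k′) (proj₂ opt)) )
    bounded′)
    where
    grow : card (insert S v) + k′ ≡ card S + suc k′
    grow = trans (cong (_+ k′) (card-insert S v Sv)) (≡-sym (+-suc (card S) k′))
    bounded′ : Bounded (G ∖ insert S v) k′
    bounded′ m′ valid′ with valid , m′v ← mate-insert⁻¹ G S valid′
      with M , _ , sizeM , _ ← toList (G ∖ S) m′ valid = begin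
      n G                         ≡⟨ sizeM ⟨
      exposed m′ + 2 * length M   ≤⟨ +-monoʳ-≤ (exposed m′) (*-monoʳ-≤ 2 (s≤s⁻¹ (≤∧≢⇒< l≤k l≢k))) ⟩
      exposed m′ + 2 * k′         ∎
      where
      open ≤-Reasoning
      l≤k : length M ≤ k
      l≤k = *-cancelˡ-≤ 2 (+-cancelˡ-≤ (exposed m′) _ _
        (≤-trans (≤-reflexive sizeM) (bounded m′ valid)))
      l≢k : length M ≢ k
      l≢k l≡k = essential
        (valid , trans (cong (λ l → exposed m′ + 2 * l) (≡-sym l≡k)) sizeM) m′v

reduced : (G : Graph) (ν : ℕ) → MatchNum G ν → Reduced G ν
reduced G ν ((M , matching , refl) , largest)
  with m , (inv , edge) , size , _ ← fromList G M matching =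
  subst (Reduced G) (cong (_+ ν) (sum-zero (n G)))
    (reduce G ν ∅ m ((inv , λ v mv≢v → ∖-adj G ∅ (edge v mv≢v) refl refl) , size) bounded)
  where
  ∅ : Fin (n G) → Bool
  ∅ _ = false
  bounded : Bounded (G ∖ ∅) ν
  bounded m (inv , edge)
    with M′ , matching′ , size′ , _ ← toList G m (inv , λ v mv≢v → proj₁ (∖-adj⁻¹ G ∅ (edge v mv≢v))) =
    ≤-trans (≤-reflexive (≡-sym size′))
      (+-monoʳ-≤ (exposed m) (*-monoʳ-≤ 2 (largest M′ matching′)))

-- The edge bound

card-zero : (P : Fin N → Bool) → card P ≡ 0 → ∀ i → P i ≡ false
card-zero {N} P P≡0 i with P i in Pi
... | false = refl
... | true  with () ← trans (≡-sym P≡0) (card-remove P i Pi)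

closedAdj-diag : (G : Graph) (i : Fin (n G)) → closedAdj G i i ≡ 1
closedAdj-diag G i rewrite irrefl G i | ==-refl i = refl

closedAdj-off : (G : Graph) {i j : Fin (n G)} → i ≢ j → closedAdj G i j ≡ 𝟙 (adj G i j)
closedAdj-off G {i} {j} i≢j rewrite ==-false {i = j} {i} (i≢j ∘ ≡-sym) = +-identityʳ _

closedAdj≤1 : (G : Graph) (i j : Fin (n G)) → closedAdj G i j ≤ 1
closedAdj≤1 G i j with i ≟ j
... | yes refl = ≤-reflexive (closedAdj-diag G i)
... | no i≢j   = ≤-trans (≤-reflexive (closedAdj-off G i≢j)) (𝟙≤1 _)

𝟙-injective : ∀ {a b} → 𝟙 a ≡ 𝟙 b → a ≡ b
𝟙-injective {true}  {true}  _ = refl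
𝟙-injective {false} {false} _ = refl

∧-true : ∀ {a b} → a ≡ true → b ≡ true → a ∧ b ≡ true
∧-true refl refl = refl

module Counting (G : Graph) (ν : ℕ) (R : Reduced G ν) where
  open Reduced R public

  H : Graph
  H = G ∖ S

  X U : Fin (n G) → Bool
  X i = not (mate i == i)
  U i = (mate i == i) ∧ not (S i)

  s u : ℕ
  s = card S
  u = card U

  data Kind (i : Fin (n G)) : Set where
    inS : S i ≡ true  → X i ≡ false → U i ≡ false → Kind i
    inX : S i ≡ false → X i ≡ true  → U i ≡ false → Kind i
    inU : S i ≡ false → X i ≡ false → U i ≡ true  → Kind i

  S⇒exposed : ∀ {i} → S i ≡ true → mate i ≡ i
  S⇒exposed = deleted⇒exposed G S (proj₁ optimal)

  kind : ∀ i → Kind i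
  kind i = byCases (mate i ≟ i) (S i) refl
    where
    byCases : Dec (mate i ≡ i) → ∀ b → S i ≡ b → Kind i
    byCases (yes mi) true Si = inS Si (cong not Mi) (cong₂ (λ a b → a ∧ not b) Mi Si)
      where Mi = dec-true (mate i ≟ i) mi
    byCases (yes mi) false Si = inU Si (cong not Mi) (cong₂ (λ a b → a ∧ not b) Mi Si)
      where Mi = dec-true (mate i ≟ i) mi
    byCases (no mi≢i) true Si = ⊥-elim (mi≢i (S⇒exposed Si))
    byCases (no mi≢i) false Si = inX Si (cong not Mi) (cong (_∧ not (S i)) Mi)
      where Mi = dec-false (mate i ≟ i) mi≢i

  U⇒exposed : ∀ {i} → U i ≡ true → mate i ≡ i
  U⇒exposed {i} Ui with mate i ≟ i
  ... | yes mi = mi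

  U⇒¬S : ∀ {i} → U i ≡ true → S i ≡ false
  U⇒¬S {i} Ui with kind i
  ... | inU Si _ _ = Si
  ... | inS _ _ Ui′ = ⊥-elim (true≢false Ui Ui′)
  ... | inX _ _ Ui′ = ⊥-elim (true≢false Ui Ui′)

  X⇒¬S : ∀ {i} → X i ≡ true → S i ≡ false
  X⇒¬S {i} Xi with kind i
  ... | inX Si _ _ = Si
  ... | inS _ Xi′ _ = ⊥-elim (true≢false Xi Xi′)
  ... | inU _ Xi′ _ = ⊥-elim (true≢false Xi Xi′)

  X⇒¬U : ∀ {i j} → X i ≡ true → U j ≡ true → i ≢ j
  X⇒¬U {i} Xi Ui refl with kind i
  ... | inS _ Xi′ _ = true≢false Xi Xi′
  ... | inX _ _ Ui′ = true≢false Ui Ui′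
  ... | inU _ Xi′ _ = true≢false Xi Xi′

  exposed≡ : exposed mate ≡ s + u
  exposed≡ = trans (sum-cong pointwise) (sum-+ (𝟙 ∘ S) (𝟙 ∘ U))
    where
    pointwise : ∀ i → 𝟙 (mate i == i) ≡ 𝟙 (S i) + 𝟙 (U i)
    pointwise i with S i in Si
    ... | true  rewrite dec-true (mate i ≟ i) (S⇒exposed Si) = refl
    ... | false = cong 𝟙 (≡-sym (∧-identityʳ _))

  n≡ : n G ≡ s + u + 2 * k
  n≡ = trans (≡-sym (proj₂ optimal)) (cong (_+ 2 * k) exposed≡)

  card-X : card X ≡ 2 * k
  card-X = +-cancelˡ-≡ (exposed mate) _ _
    (trans (card-not (λ i → mate i == i)) (≡-sym (proj₂ optimal)))

  card-¬S : card (not ∘ S) ≡ u + 2 * k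
  card-¬S = +-cancelˡ-≡ s _ _ (trans (card-not S) (trans n≡ (+-assoc s u (2 * k))))

  U-independent : ∀ {i j} → U i ≡ true → U j ≡ true → adj G i j ≡ false
  U-independent {i} {j} Ui Uj with adj G i j in ij
  ... | false = refl
  ... | true  = ⊥-elim (nonaugmentable H k bounded optimal (U⇒exposed Ui) (U⇒exposed Uj)
    (∖-adj G S ij (U⇒¬S Ui) (U⇒¬S Uj)))

  u≤ : ∀ {α} → IndepNum G α → u ≤ α
  u≤ {α} (_ , largest) = subst (_≤ α) size-U (largest (tabulate U) λ i j i∈ j∈ →
    U-independent (∈⇒ i∈) (∈⇒ j∈))
    where
    size-U = trans (∣∣≡card (tabulate U)) (sum-cong λ i → cong 𝟙 (lookup∘tabulate U i))
    ∈⇒ : ∀ {i} → i ∈ tabulate U → U i ≡ true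
    ∈⇒ {i} i∈ = trans (≡-sym (lookup∘tabulate U i)) ([]=⇒lookup i∈)

  -- For `i` in `X` this is its only neighbour in `U`, if it has one. Being total, `t` charges
  -- exactly one unit to each `i` in `X` in either case, so the sum of `bound` does not depend on
  -- it.
  t : Fin (n G) → Fin (n G)
  t i with Fin.any? (λ j → (U j ∧ adj G i j) Bool.≟ true)
  ... | yes (j , _) = j
  ... | no _        = i

  t-unique : ∀ {i j} → X i ≡ true → U j ≡ true → adj G i j ≡ true → j ≡ t i
  t-unique {i} {j} Xi Uj ij with Fin.any? (λ j → (U j ∧ adj G i j) Bool.≟ true)
  ... | no none = ⊥-elim (none (j , ∧-true Uj ij))
  ... | yes (j′ , both) with U j′ in Uj′ | adj G i j′ in ij′
  ...   | true | true = missedNeighbourUnique H k bounded inessential optimal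
    (U⇒exposed Uj) (U⇒exposed Uj′)
    (∖-adj G S ij (X⇒¬S Xi) (U⇒¬S Uj)) (∖-adj G S ij′ (X⇒¬S Xi) (U⇒¬S Uj′))

  -- The summands allow, in order: rows in `S`, columns in `S` of the other rows, the block `X` by
  -- `X` with its diagonal, the edges from `X` to `U`, their transposes, and the diagonal of `U`.
  -- Each is a product, so its double sum factorises or collapses to a single sum.
  bound : Fin (n G) → Fin (n G) → ℕ
  bound i j = 𝟙 (S i) * 1 + (𝟙 (not (S i)) * 𝟙 (S j) + (𝟙 (X i) * 𝟙 (X j)
    + (𝟙 (X i) * 𝟙 (j == t i) + (𝟙 (X j) * 𝟙 (i == t j) + 𝟙 (U i) * 𝟙 (j == i)))))

  closedAdj≤bound : ∀ i j → closedAdj G i j ≤ bound i j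
  closedAdj≤bound i j with kind i | kind j
  ... | inS Si _ _ | _ rewrite Si = ≤-trans (closedAdj≤1 G i j) (m≤m+n 1 _)
  ... | inX Si _ _ | inS Sj _ _ rewrite Si | Sj = ≤-trans (closedAdj≤1 G i j) (m≤m+n 1 _)
  ... | inU Si _ _ | inS Sj _ _ rewrite Si | Sj = ≤-trans (closedAdj≤1 G i j) (m≤m+n 1 _)
  ... | inX Si Xi _ | inX Sj Xj _ rewrite Si | Sj | Xi | Xj = ≤-trans (closedAdj≤1 G i j) (m≤m+n 1 _)
  ... | inX Si Xi Ui | inU Sj Xj Uj with X⇒¬U Xi Uj | t-unique Xi Uj
  ...   | i≢j | unique rewrite closedAdj-off G i≢j | Si | Sj | Xi | Xj | Ui with adj G i j
  ...     | false = z≤n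
  ...     | true rewrite dec-true (j ≟ t i) (unique refl) = ≤-refl
  closedAdj≤bound i j | inU Si Xi Ui | inX Sj Xj Uj with X⇒¬U Xj Ui | t-unique Xj Ui
  ...   | j≢i | unique
    rewrite closedAdj-off G (j≢i ∘ ≡-sym) | Si | Sj | Xi | Xj | Graph.sym G i j with adj G j i
  ...     | false = z≤n
  ...     | true rewrite dec-true (i ≟ t j) (unique refl) = s≤s z≤n
  closedAdj≤bound i j | inU Si Xi Ui | inU Sj Xj Uj with U-independent Ui Uj
  ...   | ij rewrite ij | Si | Sj | Xi | Xj | Ui = ≤-reflexive (≡-sym (+-identityʳ _))

  total : ℕ
  total = s * n G + ((u + 2 * k) * s + (2 * k * (2 * k) + (2 * k + (2 * k + u))))

  ∑∑-bound : ∑∑ bound ≡ total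
  ∑∑-bound = trans (∑∑-+ _ _) (cong₂ _+_ (trans (∑∑-* (𝟙 ∘ S) (λ _ → 1)) (cong (s *_) (sum-one (n G))))
    (trans (∑∑-+ _ _) (cong₂ _+_ (trans (∑∑-* (𝟙 ∘ not ∘ S) (𝟙 ∘ S)) (cong (_* s) card-¬S))
    (trans (∑∑-+ _ _) (cong₂ _+_ (trans (∑∑-* (𝟙 ∘ X) (𝟙 ∘ X)) (cong₂ _*_ card-X card-X))
    (trans (∑∑-+ _ _) (cong₂ _+_ (trans (∑∑-point (𝟙 ∘ X) t) card-X)
    (trans (∑∑-+ _ _) (cong₂ _+_ (trans (sum-comm (λ i j → 𝟙 (X j) * 𝟙 (i == t j)))
        (trans (∑∑-point (𝟙 ∘ X) t) card-X))
      (∑∑-point (𝟙 ∘ U) (λ i → i)))))))))))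

  edges-bound : 2 * edges G + n G ≤ total
  edges-bound = begin
    2 * edges G + n G ≡⟨ 2*edges+n G ⟩
    ∑∑ (closedAdj G)  ≤⟨ ∑∑-mono closedAdj≤bound ⟩
    ∑∑ bound          ≡⟨ ∑∑-bound ⟩
    total             ∎
    where open ≤-Reasoning

  module Tight (tight : total ≤ 2 * edges G + n G) where

    closedAdj≡bound : ∀ i j → closedAdj G i j ≡ bound i j
    closedAdj≡bound = ∑∑-mono-tight closedAdj≤bound (begin
      ∑∑ bound          ≡⟨ ∑∑-bound ⟩
      total             ≤⟨ tight ⟩
      2 * edges G + n G ≡⟨ 2*edges+n G ⟩
      ∑∑ (closedAdj G)  ∎)
      where open ≤-Reasoning

    adj≡bound : ∀ {i j} → i ≢ j → 𝟙 (adj G i j) ≡ bound i j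
    adj≡bound i≢j = trans (≡-sym (closedAdj-off G i≢j)) (closedAdj≡bound _ _)

    k≡0⇒split : k ≡ 0 → ∀ i j → adj G i j ≡ neq i j ∧ (S i ∨ S j)
    k≡0⇒split k≡0 i j with i ≟ j
    ... | yes refl = irrefl G i
    ... | no i≢j = 𝟙-injective (trans (adj≡bound i≢j) bound≡)
      where
      X≡false : ∀ i → X i ≡ false
      X≡false = card-zero X (trans card-X (cong (2 *_) k≡0))
      bound≡ : bound i j ≡ 𝟙 (S i ∨ S j)
      bound≡ rewrite X≡false i | X≡false j | ==-false {i = j} {i} (i≢j ∘ ≡-sym) | *-zeroʳ (𝟙 (U i))
        with S i | S j
      ... | true  | _     = refl
      ... | false | true  = refl
      ... | false | false = refl

    module _ (s≡0 : s ≡ 0) where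

      S≡false : ∀ i → S i ≡ false
      S≡false = card-zero S s≡0

      adj-H : ∀ {i j} → adj G i j ≡ true → adj H i j ≡ true
      adj-H ij = ∖-adj G S ij (S≡false _) (S≡false _)

      -- What is left of `bound` when `S` is empty, with the membership tests as arguments, so that
      -- one of them can be replaced by its value independently of the others.
      weight : (xᵢ xⱼ tᵢ tⱼ : Bool) → ℕ → ℕ
      weight xᵢ xⱼ tᵢ tⱼ r = 𝟙 xᵢ * 𝟙 xⱼ + (𝟙 xᵢ * 𝟙 tᵢ + (𝟙 xⱼ * 𝟙 tⱼ + r))

      bound≡weight : ∀ {i j xᵢ xⱼ} → X i ≡ xᵢ → X j ≡ xⱼ →
        bound i j ≡ weight xᵢ xⱼ (j == t i) (i == t j) (𝟙 (U i) * 𝟙 (j == i))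
      bound≡weight {i} {j} refl refl =
        cong₂ (λ a b → 𝟙 a * 1 + (𝟙 (not a) * 𝟙 b + weight (X i) (X j) (j == t i) (i == t j) (𝟙 (U i) * 𝟙 (j == i))))
          (S≡false i) (S≡false j)

      adj≡weight : ∀ {i j xᵢ xⱼ} → i ≢ j → X i ≡ xᵢ → X j ≡ xⱼ →
        𝟙 (adj G i j) ≡ weight xᵢ xⱼ (j == t i) (i == t j) (𝟙 (U i) * 𝟙 (j == i))
      adj≡weight i≢j Xi Xj = trans (adj≡bound i≢j) (bound≡weight Xi Xj)

      ¬X⇒U : ∀ {i} → X i ≡ false → U i ≡ true
      ¬X⇒U {i} Xi with kind i
      ... | inS Si _ _  = ⊥-elim (true≢false Si (S≡false i))
      ... | inX _ Xi′ _ = ⊥-elim (true≢false Xi′ Xi)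
      ... | inU _ _ Ui  = Ui

      1≤𝟙 : ∀ {b c} → 𝟙 b ≡ suc c → b ≡ true
      1≤𝟙 {true} _ = refl

      clique : ∀ {i j} → X i ≡ true → X j ≡ true → i ≢ j → adj G i j ≡ true
      clique Xi Xj i≢j = 1≤𝟙 (adj≡weight i≢j Xi Xj)

      -- The default t i = i, for i without neighbours in U, would make bound i i exceed 1.
      t≢ : ∀ {i} → X i ≡ true → i ≢ t i
      t≢ {i} Xi i≡ti with () ← trans (≡-sym (closedAdj-diag G i)) (trans (closedAdj≡bound i i)
        (trans (bound≡weight Xi Xi)
          (cong (λ b → weight true true b b (𝟙 (U i) * 𝟙 (i == i))) (dec-true (i ≟ t i) i≡ti))))

      -- The entry at `i` and `t i` gets one unit from the `t` summand and a second one if `t i`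
      -- lies in `X`. An adjacency is at most 1, so `t i` must lie in `U`, and it is then adjacent
      -- to `i`.
      adj-t≡ : ∀ {i x} → X i ≡ true → X (t i) ≡ x → ∃ λ r → 𝟙 (adj G i (t i)) ≡ 𝟙 x + suc r
      adj-t≡ {i} {true} Xi Xt = _ , trans (adj≡weight (t≢ Xi) Xi Xt)
        (cong (λ b → weight true true b (i == t (t i)) (𝟙 (U i) * 𝟙 (t i == i))) (==-refl (t i)))
      adj-t≡ {i} {false} Xi Xt = _ , trans (adj≡weight (t≢ Xi) Xi Xt)
        (cong (λ b → weight true false b (i == t (t i)) (𝟙 (U i) * 𝟙 (t i == i))) (==-refl (t i)))

      t∈U : ∀ {i} → X i ≡ true → U (t i) ≡ true
      t∈U {i} Xi = byCase (X (t i)) refl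
        where
        byCase : ∀ x → X (t i) ≡ x → U (t i) ≡ true
        byCase false Xt = ¬X⇒U Xt
        byCase true  Xt with r , eq ← adj-t≡ Xi Xt
          with s≤s () ← subst (_≤ 1) eq (𝟙≤1 (adj G i (t i)))

      adj-t : ∀ {i} → X i ≡ true → adj G i (t i) ≡ true
      adj-t {i} Xi = byCase (X (t i)) refl
        where
        byCase : ∀ x → X (t i) ≡ x → adj G i (t i) ≡ true
        byCase false Xt = 1≤𝟙 (proj₂ (adj-t≡ Xi Xt))
        byCase true  Xt = clique Xi Xt (t≢ Xi)

      X-moved : ∀ {i} → X i ≡ true → mate i ≢ i
      X-moved {i} Xi mi = true≢false Xi (cong not (dec-true (mate i ≟ i) mi))

      -- If t i ≢ t j, matching i with t i instead of with mate i leaves mate i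
      -- and t j exposed; both are adjacent to j, or equal to and adjacent to it.
      t-constant : ∀ {i j} → X i ≡ true → X j ≡ true → t i ≡ t j
      t-constant {i} {j} Xi Xj = decidable-stable (t i ≟ t j) contra
        where
        inv = proj₁ (proj₁ optimal)
        i′ = mate i
        i′-moved : mate i′ ≢ i′
        i′-moved = mate-moved {m = mate} inv (X-moved Xi)
        Xi′ : X i′ ≡ true
        Xi′ = cong not (dec-false (mate i′ ≟ i′) i′-moved)
        contra : t i ≢ t j → ⊥
        contra ti≢tj = byCase (j ≟ i′)
          where
          module M = Rotation (rotate H k mate i′ (t i) optimal i′-moved (U⇒exposed (t∈U Xi))
            (trans (cong (λ v → adj H v (t i)) (inv i)) (adj-H (adj-t Xi))))
          tj-exposed : M.mate (t j) ≡ t j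
          tj-exposed = trans (M.other (t j) (X⇒¬U Xi′ (t∈U Xj) ∘ ≡-sym)
            (λ eq → X⇒¬U Xi (t∈U Xj) (≡-sym (trans eq (inv i)))) (ti≢tj ∘ ≡-sym))
            (U⇒exposed (t∈U Xj))
          byCase : Dec (j ≡ i′) → ⊥
          byCase (yes j≡i′) = nonaugmentable H k bounded M.optimal M.at-x tj-exposed
            (trans (cong (λ v → adj H v (t j)) (≡-sym j≡i′)) (adj-H (adj-t Xj)))
          byCase (no j≢i′) = X⇒¬U Xi′ (t∈U Xj) (missedNeighbourUnique H k bounded inessential
            M.optimal M.at-x tj-exposed (adj-H (clique Xj Xi′ j≢i′)) (adj-H (adj-t Xj)))

      s≡0⇒clique : 1 ≤ k → ∃ λ κ → card κ ≡ 2 * k + 1 × (∀ i j → adj G i j ≡ neq i j ∧ (κ i ∧ κ j))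
      s≡0⇒clique 1≤k = insert X u₀
        , trans (card-insert X u₀ Xu₀) (trans (cong suc card-X) (+-comm 1 (2 * k))) , clique-adj
        where
        -- `1 ≤ k` enters here: some vertex of `X` must exist to name the common neighbour in `U`.
        witness = card-positive X (subst (1 ≤_) (≡-sym card-X) (≤-trans 1≤k (m≤m+n k _)))
        u₀ = t (proj₁ witness)
        t≡u₀ : ∀ {i} → X i ≡ true → t i ≡ u₀
        t≡u₀ Xi = t-constant Xi (proj₂ witness)
        Xu₀ : X u₀ ≡ false
        Xu₀ with X u₀ in eq
        ... | false = refl
        ... | true  = ⊥-elim (X⇒¬U eq (t∈U (proj₂ witness)) refl)
        drop₀ : ∀ {i j} b → i ≢ j → 𝟙 b + 𝟙 (U i) * 𝟙 (j == i) ≡ 𝟙 b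
        drop₀ {i} {j} b i≢j rewrite ==-false {i = j} {i} (i≢j ∘ ≡-sym) | *-zeroʳ (𝟙 (U i)) = +-identityʳ (𝟙 b)
        off-diagonal : ∀ {i j} xᵢ xⱼ → X i ≡ xᵢ → X j ≡ xⱼ → i ≢ j →
          adj G i j ≡ (xᵢ ∨ (i == u₀)) ∧ (xⱼ ∨ (j == u₀))
        off-diagonal true true Xi Xj i≢j = clique Xi Xj i≢j
        off-diagonal {i} {j} true false Xi Xj i≢j = 𝟙-injective
          (trans (adj≡weight i≢j Xi Xj) (trans (cong (_+ 𝟙 (U i) * 𝟙 (j == i)) (+-identityʳ _))
            (trans (drop₀ (j == t i) i≢j) (cong (λ v → 𝟙 (j == v)) (t≡u₀ Xi)))))
        off-diagonal {i} {j} false true Xi Xj i≢j = trans (𝟙-injective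
          (trans (adj≡weight i≢j Xi Xj) (trans (cong (_+ 𝟙 (U i) * 𝟙 (j == i)) (+-identityʳ _))
            (trans (drop₀ (i == t j) i≢j) (cong (λ v → 𝟙 (i == v)) (t≡u₀ Xj))))))
          (≡-sym (∧-identityʳ _))
        off-diagonal {i} {j} false false Xi Xj i≢j = trans
          (𝟙-injective (trans (adj≡weight i≢j Xi Xj) (drop₀ false i≢j))) (≡-sym distinct)
          where
          distinct : (i == u₀) ∧ (j == u₀) ≡ false
          distinct with i ≟ u₀ | j ≟ u₀
          ... | yes i≡ | yes j≡ = ⊥-elim (i≢j (trans i≡ (≡-sym j≡)))
          ... | yes _  | no _   = refl
          ... | no _   | _      = refl
        clique-adj : ∀ i j → adj G i j ≡ neq i j ∧ (insert X u₀ i ∧ insert X u₀ j)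
        clique-adj i j with i ≟ j
        ... | yes refl = irrefl G i
        ... | no i≢j   = off-diagonal (X i) (X j) refl refl i≢j

-- Clique and split graphs

isLeft : {A B : Set} → A ⊎ B → Bool
isLeft (inj₁ _) = true
isLeft (inj₂ _) = false

-- Isomorphisms are obtained by sorting the vertices of both graphs into two blocks of equal sizes
-- and composing the sortings.
Partition : (Fin N → Bool) → ℕ → ℕ → Set
Partition {N} P p q = Σ (Fin N ↔ (Fin p ⊎ Fin q)) λ f → ∀ i → P i ≡ isLeft (Inverse.to f i)

partition-suc : (P : Fin (suc N) → Bool) {p q : ℕ} → Partition (P ∘ suc) p q →
  Partition P (𝟙 (P zero) + p) (𝟙 (not (P zero)) + q)
partition-suc {N} P {p} {q} (f , P≡) with P zero in P₀
... | true = mk↔ₛ′ to from to∘from from∘to , λ { zero → P₀ ; (suc i) → trans (P≡ i) (shift (Inverse.to f i)) }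
  where
  grow : Fin p ⊎ Fin q → Fin (suc p) ⊎ Fin q
  grow = Sum⊎.map₁ suc
  shift : ∀ x → isLeft x ≡ isLeft (grow x)
  shift (inj₁ _) = refl
  shift (inj₂ _) = refl
  to : Fin (suc N) → Fin (suc p) ⊎ Fin q
  to zero    = inj₁ zero
  to (suc i) = grow (Inverse.to f i)
  from : Fin (suc p) ⊎ Fin q → Fin (suc N)
  from (inj₁ zero)    = zero
  from (inj₁ (suc x)) = suc (Inverse.from f (inj₁ x))
  from (inj₂ y)       = suc (Inverse.from f (inj₂ y))
  to∘from : ∀ x → to (from x) ≡ x
  to∘from (inj₁ zero)    = refl
  to∘from (inj₁ (suc x)) = cong grow (Inverse.strictlyInverseˡ f (inj₁ x))
  to∘from (inj₂ y)       = cong grow (Inverse.strictlyInverseˡ f (inj₂ y))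
  from-grow : ∀ x → from (grow x) ≡ suc (Inverse.from f x)
  from-grow (inj₁ _) = refl
  from-grow (inj₂ _) = refl
  from∘to : ∀ i → from (to i) ≡ i
  from∘to zero    = refl
  from∘to (suc i) = trans (from-grow (Inverse.to f i)) (cong suc (Inverse.strictlyInverseʳ f i))
... | false = mk↔ₛ′ to from to∘from from∘to , λ { zero → P₀ ; (suc i) → trans (P≡ i) (shift (Inverse.to f i)) }
  where
  grow : Fin p ⊎ Fin q → Fin p ⊎ Fin (suc q)
  grow = Sum⊎.map₂ suc
  shift : ∀ x → isLeft x ≡ isLeft (grow x)
  shift (inj₁ _) = refl
  shift (inj₂ _) = refl
  to : Fin (suc N) → Fin p ⊎ Fin (suc q)
  to zero    = inj₂ zero
  to (suc i) = grow (Inverse.to f i)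
  from : Fin p ⊎ Fin (suc q) → Fin (suc N)
  from (inj₁ x)       = suc (Inverse.from f (inj₁ x))
  from (inj₂ zero)    = zero
  from (inj₂ (suc y)) = suc (Inverse.from f (inj₂ y))
  to∘from : ∀ x → to (from x) ≡ x
  to∘from (inj₁ x)       = cong grow (Inverse.strictlyInverseˡ f (inj₁ x))
  to∘from (inj₂ zero)    = refl
  to∘from (inj₂ (suc y)) = cong grow (Inverse.strictlyInverseˡ f (inj₂ y))
  from-grow : ∀ x → from (grow x) ≡ suc (Inverse.from f x)
  from-grow (inj₁ _) = refl
  from-grow (inj₂ _) = refl
  from∘to : ∀ i → from (to i) ≡ i
  from∘to zero    = refl
  from∘to (suc i) = trans (from-grow (Inverse.to f i)) (cong suc (Inverse.strictlyInverseʳ f i))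

opaque
  unfolding sum

  partition : (P : Fin N → Bool) → Partition P (card P) (card (not ∘ P))
  partition {zero}  P = mk↔ₛ′ (λ ()) (λ { (inj₁ ()) ; (inj₂ ()) }) (λ { (inj₁ ()) ; (inj₂ ()) }) (λ ()) , λ ()
  partition {suc N} P = partition-suc P (partition (P ∘ suc))

  card-<ᵇ : ∀ {a} → a ≤ N → card {N} (λ i → toℕ i <ᵇ a) ≡ a
  card-<ᵇ {N}     {zero}  _         = sum-zero N
  card-<ᵇ {suc N} {suc a} (s≤s a≤N) = cong suc (card-<ᵇ a≤N)

transfer : ∀ {M} (P : Fin M → Bool) (Q : Fin N → Bool) → card P ≡ card Q →
  card (not ∘ P) ≡ card (not ∘ Q) → Σ (Fin M ↔ Fin N) λ f → ∀ i → P i ≡ Q (Inverse.to f i)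
transfer {M = M} P Q P≡Q ¬P≡¬Q
  with f , Pf ← subst (λ p → Partition P p (card (not ∘ Q))) P≡Q
                  (subst (Partition P (card P)) ¬P≡¬Q (partition P))
     | g , Qg ← partition Q =
  ↔-trans f (↔-sym g) , λ i → begin
    P i                                              ≡⟨ Pf i ⟩
    isLeft (Inverse.to f i)                          ≡⟨ cong isLeft (Inverse.strictlyInverseˡ g _) ⟨
    isLeft (Inverse.to g (Inverse.from g (Inverse.to f i))) ≡⟨ Qg _ ⟨
    Q (Inverse.from g (Inverse.to f i))              ∎
  where open ≡-Reasoning

neq-↔ : ∀ {M} (f : Fin M ↔ Fin N) i j → neq i j ≡ neq (Inverse.to f i) (Inverse.to f j)
neq-↔ f i j with i ≟ j | Inverse.to f i ≟ Inverse.to f j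
... | yes _    | yes _  = refl
... | no _     | no _   = refl
... | yes refl | no ≢   = ⊥-elim (≢ refl)
... | no i≢j   | yes eq = ⊥-elim (i≢j (trans (≡-sym (Inverse.strictlyInverseʳ f i))
  (trans (cong (Inverse.from f) eq) (Inverse.strictlyInverseʳ f j))))

-- With `_∧_` the graph is a clique on `κ` plus isolated vertices, with `_∨_` a clique on `κ` joined
-- completely to an independent rest. Such a graph is known up to isomorphism from the sizes of its
-- two classes.
DeterminedBy : (Bool → Bool → Bool) → (G : Graph) → (Fin (n G) → Bool) → Set
DeterminedBy _⊕_ G κ = ∀ i j → adj G i j ≡ neq i j ∧ (κ i ⊕ κ j)

CliqueOn SplitOn : (G : Graph) → (Fin (n G) → Bool) → Set
CliqueOn = DeterminedBy _∧_
SplitOn  = DeterminedBy _∨_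

determined-≅ : ∀ _⊕_ (G H : Graph) κ μ → DeterminedBy _⊕_ G κ → DeterminedBy _⊕_ H μ →
  card κ ≡ card μ → card (not ∘ κ) ≡ card (not ∘ μ) → G ≅ H
determined-≅ _⊕_ G H κ μ Gκ Hμ κ≡μ ¬κ≡¬μ with f , κf ← transfer κ μ κ≡μ ¬κ≡¬μ =
  f , λ i j → trans (Gκ i j) (trans (cong₂ _∧_ (neq-↔ f i j) (cong₂ _⊕_ (κf i) (κf j)))
    (≡-sym (Hμ (Inverse.to f i) (Inverse.to f j))))

-- Independence numbers of clique and split graphs

card-mono : {P Q : Fin N → Bool} → (∀ i → P i ≡ true → Q i ≡ true) → card P ≤ card Q
card-mono {P = P} {Q} P⊆Q = sum-mono pointwise
  where
  pointwise : ∀ i → 𝟙 (P i) ≤ 𝟙 (Q i)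
  pointwise i with P i in Pi
  ... | false = z≤n
  ... | true  = ≤-reflexive (cong 𝟙 (≡-sym (P⊆Q i Pi)))

card≤1 : (P : Fin N → Bool) → (∀ i j → P i ≡ true → P j ≡ true → i ≡ j) → card P ≤ 1
card≤1 P unique with card P in eq
... | zero  = z≤n
... | suc c with i , Pi ← card-positive P (≤-trans (s≤s z≤n) (≤-reflexive (≡-sym eq))) =
  subst (_≤ 1) eq (subst (card P ≤_) (card-point i)
    (card-mono λ j Pj → dec-true (j ≟ i) (unique j i Pj Pi)))

independent⇒≡ : (G : Graph) {I : Fin (n G) → Bool} →
  (∀ i j → I i ≡ true → I j ≡ true → adj G i j ≡ false) → ∀ {i j} →
  I i ≡ true → I j ≡ true → (i ≢ j → adj G i j ≡ true) → i ≡ j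
independent⇒≡ G indep {i} {j} Ii Ij joined = decidable-stable (i ≟ j) λ i≢j →
  true≢false (joined i≢j) (indep i j Ii Ij)

determined-true : ∀ _⊕_ (G : Graph) κ → DeterminedBy _⊕_ G κ → ∀ {i j} →
  κ i ⊕ κ j ≡ true → i ≢ j → adj G i j ≡ true
determined-true _⊕_ G κ Gκ {i} {j} κκ i≢j = trans (Gκ i j) (∧-true (cong not (==-false i≢j)) κκ)

indepNum : (G : Graph) {a : ℕ} (I : Fin (n G) → Bool) →
  (∀ i j → I i ≡ true → I j ≡ true → adj G i j ≡ false) → card I ≡ a →
  (∀ J → (∀ i j → J i ≡ true → J j ≡ true → adj G i j ≡ false) → card J ≤ a) → IndepNum G a
indepNum G I indep size largest =
  (tabulate I , (λ i j i∈ j∈ → indep i j (member i∈) (member j∈))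
  , trans (∣∣≡card (tabulate I)) (trans (sum-cong λ i → cong 𝟙 (lookup∘tabulate I i)) size))
  , λ S S-indep → ≤-trans (≤-reflexive (∣∣≡card S)) (largest (lookup S) λ i j Si Sj →
      S-indep i j (lookup⇒[]= i S Si) (lookup⇒[]= j S Sj))
  where
  member : ∀ {i} → i ∈ tabulate I → I i ≡ true
  member {i} i∈ = trans (≡-sym (lookup∘tabulate I i)) ([]=⇒lookup i∈)

indepNum-unique : (G : Graph) {a b : ℕ} → IndepNum G a → IndepNum G b → a ≡ b
indepNum-unique G ((S , S-indep , refl) , a-max) ((T , T-indep , refl) , b-max) =
  ≤-antisym (b-max S S-indep) (a-max T T-indep)

not-true : ∀ {b} → not b ≡ true → b ≡ false
not-true {false} _ = refl

-- An independent set meets the clique at most once; one clique vertex together with all isolated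
-- ones attains this.
clique-indepNum : (G : Graph) (κ : Fin (n G) → Bool) → CliqueOn G κ → 1 ≤ card κ →
  IndepNum G (suc (card (not ∘ κ)))
clique-indepNum G κ Gκ 1≤κ with v , κv ← card-positive κ 1≤κ =
  indepNum G (insert (not ∘ κ) v) indep (card-insert (not ∘ κ) v (cong not κv)) largest
  where
  indep : ∀ i j → insert (not ∘ κ) v i ≡ true → insert (not ∘ κ) v j ≡ true → adj G i j ≡ false
  indep i j Ii Ij rewrite Gκ i j with i ≟ j
  ... | yes _ = refl
  ... | no i≢j with κ i | κ j
  ...   | false | _     = refl
  ...   | true  | false = refl
  ...   | true  | true  = ⊥-elim (i≢j (trans (==-sound i v Ii) (≡-sym (==-sound j v Ij))))
  largest : ∀ J → (∀ i j → J i ≡ true → J j ≡ true → adj G i j ≡ false) →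
    card J ≤ suc (card (not ∘ κ))
  largest J J-indep = begin
    card J                                                ≤⟨ sum-mono pointwise ⟩
    sum (λ i → 𝟙 (J i ∧ κ i) + 𝟙 (not (κ i)))             ≡⟨ sum-+ _ _ ⟩
    card (λ i → J i ∧ κ i) + card (not ∘ κ)               ≤⟨ +-monoˡ-≤ _ (card≤1 _ unique) ⟩
    suc (card (not ∘ κ))                                  ∎
    where
    open ≤-Reasoning
    pointwise : ∀ i → 𝟙 (J i) ≤ 𝟙 (J i ∧ κ i) + 𝟙 (not (κ i))
    pointwise i with J i | κ i
    ... | true  | true  = ≤-refl
    ... | true  | false = ≤-refl
    ... | false | _     = z≤n
    unique : ∀ i j → J i ∧ κ i ≡ true → J j ∧ κ j ≡ true → i ≡ j
    unique i j Ji Jj = independent⇒≡ G J-indep (∧-fst (J i) Ji) (∧-fst (J j) Jj)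
      (determined-true _∧_ G κ Gκ (∧-true (∧-snd (J i) Ji) (∧-snd (J j) Jj)))
      where
      ∧-fst : ∀ a {b} → a ∧ b ≡ true → a ≡ true
      ∧-fst true _ = refl
      ∧-snd : ∀ a {b} → a ∧ b ≡ true → b ≡ true
      ∧-snd true eq = eq

-- A vertex of `κ` is adjacent to all others, so an independent set containing one is a singleton;
-- `1 ≤ card (not ∘ κ)` covers that case.
split-indepNum : (G : Graph) (κ : Fin (n G) → Bool) → SplitOn G κ → 1 ≤ card (not ∘ κ) →
  IndepNum G (card (not ∘ κ))
split-indepNum G κ Gκ 1≤¬κ = indepNum G (not ∘ κ) indep refl largest
  where
  indep : ∀ i j → not (κ i) ≡ true → not (κ j) ≡ true → adj G i j ≡ false
  indep i j ¬κi ¬κj rewrite Gκ i j | not-true ¬κi | not-true ¬κj = ∧-zeroʳ (neq i j)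
  largest : ∀ J → (∀ i j → J i ≡ true → J j ≡ true → adj G i j ≡ false) →
    card J ≤ card (not ∘ κ)
  largest J J-indep with Fin.any? (λ i → (J i Bool.≟ true) ×-dec (κ i Bool.≟ true))
  ... | yes (i , Ji , κi) = ≤-trans (card≤1 J λ j l Jj Jl → trans (≡-sym (only Jj)) (only Jl)) 1≤¬κ
    where
    only : ∀ {j} → J j ≡ true → i ≡ j
    only {j} Jj = independent⇒≡ G J-indep Ji Jj (determined-true _∨_ G κ Gκ (cong (_∨ κ j) κi))
  ... | no none = card-mono λ i Ji → cong not (outside i Ji)
    where
    outside : ∀ i → J i ≡ true → κ i ≡ false
    outside i Ji with κ i in κi
    ... | false = refl
    ... | true  = ⊥-elim (none (i , Ji , κi))

-- Matching numbers of clique and split graphs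

remove : (Fin N → Bool) → Fin N → Fin N → Bool
remove P x i = P i ∧ not (i == x)

remove-true : (P : Fin N → Bool) {x i : Fin N} → remove P x i ≡ true → P i ≡ true × i ≢ x
remove-true P {x} {i} eq with P i | i ≟ x
... | true | no i≢x = refl , i≢x

remove-other : (P : Fin N → Bool) {x i : Fin N} → P i ≡ true → x ≢ i → remove P x i ≡ true
remove-other P Pi x≢i = ∧-true Pi (cong not (==-false (x≢i ∘ ≡-sym)))

-- The easy half of König duality: disjoint edges use different cover vertices, so each edge may
-- take one out of `κ` without uncovering the rest.
cover-bound : (κ : Fin N → Bool) (M : List (Fin N × Fin N)) →
  All (λ e → κ (proj₁ e) ≡ true ⊎ κ (proj₂ e) ≡ true) M → Unique (endpoints M) → length M ≤ card κ
cover-bound κ [] _ _ = z≤n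
cover-bound {N} κ ((x , y) ∷ M) (cover ∷ covers) ((_ ∷ x∉) ∷ (y∉ ∷ unique)) = use cover
  where
  shrink : ∀ {v} M → All (λ e → κ (proj₁ e) ≡ true ⊎ κ (proj₂ e) ≡ true) M → All (v ≢_) (endpoints M) →
    All (λ e → remove κ v (proj₁ e) ≡ true ⊎ remove κ v (proj₂ e) ≡ true) M
  shrink [] [] [] = []
  shrink (e ∷ M) (c ∷ cs) (v≢₁ ∷ v≢₂ ∷ v∉) =
    Sum⊎.map (λ κ₁ → remove-other κ κ₁ v≢₁) (λ κ₂ → remove-other κ κ₂ v≢₂) c ∷ shrink M cs v∉
  via : ∀ v → κ v ≡ true → All (v ≢_) (endpoints M) → suc (length M) ≤ card κ
  via v κv v∉ = subst (suc (length M) ≤_) (≡-sym (card-remove κ v κv))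
    (s≤s (cover-bound (remove κ v) M (shrink M covers v∉) unique))
  use : κ x ≡ true ⊎ κ y ≡ true → suc (length M) ≤ card κ
  use (inj₁ κx) = via x κx x∉
  use (inj₂ κy) = via y κy y∉

MatchingWithin : (G : Graph) → (Fin (n G) → Set) → ℕ → Set
MatchingWithin G P k = ∃ λ M → IsMatching G M × length M ≡ k × All P (endpoints M)

-- `P` describes the vertices still available and `P′` those left once `x` and `y` are used; this
-- keeps the greedy constructions disjoint.
within-cons : (G : Graph) {P P′ : Fin (n G) → Set} {k : ℕ} (x y : Fin (n G)) →
  adj G x y ≡ true → P x → P y → (∀ {v} → P′ v → P v × v ≢ x × v ≢ y) →
  MatchingWithin G P′ k → MatchingWithin G P (suc k)
within-cons G x y xy Px Py shrink (M , (adjs , unique) , size , inside) =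
  (x , y) ∷ M
  , ((xy ∷ adjs) , ((adj⇒≢ G xy ∷ All.map (λ P′v eq → proj₁ (proj₂ (shrink P′v)) (≡-sym eq)) inside)
      ∷ (All.map (λ P′v eq → proj₂ (proj₂ (shrink P′v)) (≡-sym eq)) inside ∷ unique)))
  , cong suc size
  , Px ∷ Py ∷ All.map (proj₁ ∘ shrink) inside

bipartiteMatching : (G : Graph) (P Q : Fin (n G) → Bool) →
  (∀ {i j} → P i ≡ true → Q j ≡ true → adj G i j ≡ true) →
  ∀ k → k ≤ card P → k ≤ card Q → MatchingWithin G (λ v → P v ≡ true ⊎ Q v ≡ true) k
bipartiteMatching G P Q complete zero _ _ = [] , ([] , []) , refl , []
bipartiteMatching G P Q complete (suc k) k≤P k≤Q
  with x , Px ← card-positive P (≤-trans (s≤s z≤n) k≤P)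
     | y , Qy ← card-positive Q (≤-trans (s≤s z≤n) k≤Q) =
  within-cons G x y (complete Px Qy) (inj₁ Px) (inj₂ Qy) shrink
    (bipartiteMatching G (remove P x) (remove Q y)
      (λ P′i Q′j → complete (proj₁ (remove-true P P′i)) (proj₁ (remove-true Q Q′j))) k
      (s≤s⁻¹ (subst (suc k ≤_) (card-remove P x Px) k≤P))
      (s≤s⁻¹ (subst (suc k ≤_) (card-remove Q y Qy) k≤Q)))
  where
  disjoint : ∀ {i j} → P i ≡ true → Q j ≡ true → i ≢ j
  disjoint Pi Qj = adj⇒≢ G (complete Pi Qj)
  shrink : ∀ {v} → remove P x v ≡ true ⊎ remove Q y v ≡ true →
    (P v ≡ true ⊎ Q v ≡ true) × v ≢ x × v ≢ y
  shrink (inj₁ P′v) with Pv , v≢x ← remove-true P P′v = inj₁ Pv , v≢x , disjoint Pv Qy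
  shrink (inj₂ Q′v) with Qv , v≢y ← remove-true Q Q′v = inj₂ Qv , (disjoint Px Qv ∘ ≡-sym) , v≢y

cliqueMatching : (G : Graph) (κ : Fin (n G) → Bool) →
  (∀ {i j} → κ i ≡ true → κ j ≡ true → i ≢ j → adj G i j ≡ true) →
  ∀ k → 2 * k ≤ card κ → MatchingWithin G (λ v → κ v ≡ true) k
cliqueMatching G κ complete zero _ = [] , ([] , []) , refl , []
cliqueMatching G κ complete (suc k) 2k≤κ
  with x , κx ← card-positive κ (≤-trans (s≤s z≤n) 2k≤κ)
  with rest ← s≤s⁻¹ (subst₂ _≤_ (*-suc 2 k) (card-remove κ x κx) 2k≤κ)
  with y , κ′y ← card-positive (remove κ x) (≤-trans (s≤s z≤n) rest)
  with κy , y≢x ← remove-true κ κ′y =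
  within-cons G x y (complete κx κy (y≢x ∘ ≡-sym)) κx κy shrink
    (cliqueMatching G κ″ (λ κ″i κ″j → complete (proj₁ (shrink κ″i)) (proj₁ (shrink κ″j))) k
      (s≤s⁻¹ (subst (suc (2 * k) ≤_) (card-remove (remove κ x) y κ′y) rest)))
  where
  κ″ = remove (remove κ x) y
  shrink : ∀ {v} → κ″ v ≡ true → κ v ≡ true × v ≢ x × v ≢ y
  shrink κ″v with κ′v , v≢y ← remove-true (remove κ x) κ″v
    with κv , v≢x ← remove-true κ κ′v = κv , v≢x , v≢y

-- Vertices off the clique are isolated, so a matching covers at most `2 * ν + 1` vertices, and by
-- parity it has at most `ν` edges.
clique-matchNum : (G : Graph) (κ : Fin (n G) → Bool) {ν : ℕ} → CliqueOn G κ → card κ ≡ 2 * ν + 1 →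
  MatchNum G ν
clique-matchNum G κ {ν} Gκ size
  with M , matching , length-M , _ ← cliqueMatching G κ
    (λ κi κj → determined-true _∧_ G κ Gκ (∧-true κi κj)) ν
    (subst (2 * ν ≤_) (≡-sym size) (m≤m+n _ _)) =
  (M , matching , length-M) , upper
  where
  upper : ∀ M → IsMatching G M → length M ≤ ν
  upper M matching with m , (inv , edge) , exposed+ , _ ← fromList G M matching =
    s≤s⁻¹ (*-cancelˡ-< 2 _ _ (begin-strict
      2 * length M  ≤⟨ +-cancelˡ-≤ (exposed m) _ _ (begin
          exposed m + 2 * length M ≡⟨ exposed+ ⟩
          n G                      ≡⟨ card-not κ ⟨
          card κ + card (not ∘ κ)  ≤⟨ +-monoʳ-≤ (card κ) (card-mono fixed) ⟩
          card κ + exposed m       ≡⟨ +-comm (card κ) (exposed m) ⟩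
          exposed m + card κ       ∎) ⟩
      card κ        ≡⟨ trans size (+-comm (2 * ν) 1) ⟩
      1 + 2 * ν     <⟨ ≤-refl ⟩
      2 + 2 * ν     ≡⟨ *-suc 2 ν ⟨
      2 * suc ν     ∎))
    where
    open ≤-Reasoning
    fixed : ∀ i → not (κ i) ≡ true → (m i == i) ≡ true
    fixed i ¬κi with m i ≟ i
    ... | yes _ = refl
    ... | no mi≢i with () ← trans (≡-sym (edge i mi≢i)) (trans (Gκ i (m i))
      (trans (cong (λ b → neq i (m i) ∧ (b ∧ κ (m i))) (not-true ¬κi)) (∧-zeroʳ _)))

-- The set `κ` is a vertex cover, which bounds every matching, and there are enough other vertices
-- to match all of it.
split-matchNum : (G : Graph) (κ : Fin (n G) → Bool) → SplitOn G κ → card κ ≤ card (not ∘ κ) →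
  MatchNum G (card κ)
split-matchNum G κ Gκ κ≤¬κ
  with M , matching , length-M , _ ← bipartiteMatching G κ (not ∘ κ)
    (λ {i} {j} κi ¬κj → determined-true _∨_ G κ Gκ (cong (_∨ κ j) κi)
      (λ { refl → true≢false κi (not-true ¬κj) })) (card κ) ≤-refl κ≤¬κ =
  (M , matching , length-M) , λ M (adjs , unique) → cover-bound κ M (All.map cover adjs) unique
  where
  cover : ∀ {e} → adj G (proj₁ e) (proj₂ e) ≡ true → κ (proj₁ e) ≡ true ⊎ κ (proj₂ e) ≡ true
  cover {i , j} ij with κ i | κ j | Gκ i j
  ... | true  | _     | _  = inj₁ refl
  ... | false | true  | _  = inj₂ refl
  ... | false | false | eq = ⊥-elim (true≢false ij (trans eq (∧-zeroʳ _)))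

-- Edge numbers of clique and split graphs

determined-off : {i j : Fin N} {a b : Bool} → a ≡ neq i j ∧ b → i ≢ j → a ≡ b
determined-off {i = i} {j} {b = b} eq i≢j = trans eq (cong (λ e → not e ∧ b) (==-false i≢j))

2*nC2+n : ∀ c → 2 * (c C 2) + c ≡ c * c
2*nC2+n zero = refl
2*nC2+n (suc c) = begin
  2 * (suc c C 2) + suc c         ≡⟨ cong (λ z → 2 * z + suc c) (nCk+nC[k+1]≡[n+1]C[k+1] c 1) ⟨
  2 * (c C 1 + c C 2) + suc c     ≡⟨ cong (λ z → 2 * (z + c C 2) + suc c) (nC1≡n c) ⟩
  2 * (c + c C 2) + suc c         ≡⟨ expand c (c C 2) ⟩
  suc (c + c) + (2 * (c C 2) + c) ≡⟨ cong (suc (c + c) +_) (2*nC2+n c) ⟩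
  suc (c + c) + c * c             ≡⟨ square c ⟩
  suc c * suc c                   ∎
  where
  open ≡-Reasoning
  expand : ∀ c b → 2 * (c + b) + suc c ≡ suc (c + c) + (2 * b + c)
  expand = solve-∀
  square : ∀ c → suc (c + c) + c * c ≡ suc c * suc c
  square = solve-∀

clique-edges : (G : Graph) (κ : Fin (n G) → Bool) → CliqueOn G κ → edges G ≡ card κ C 2
clique-edges G κ Gκ = *-cancelˡ-≡ _ _ 2 (+-cancelʳ-≡ (c + d) _ _ (begin
  2 * edges G + (c + d)    ≡⟨ cong (2 * edges G +_) (card-not κ) ⟩
  2 * edges G + n G        ≡⟨ 2*edges+n G ⟩
  ∑∑ (closedAdj G)         ≡⟨ ∑∑-cong pointwise ⟩
  ∑∑ (λ i j → 𝟙 (κ i) * 𝟙 (κ j) + 𝟙 (not (κ i)) * 𝟙 (j == i))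
    ≡⟨ ∑∑-+ _ _ ⟩
  ∑∑ (λ i j → 𝟙 (κ i) * 𝟙 (κ j)) + ∑∑ (λ i j → 𝟙 (not (κ i)) * 𝟙 (j == i))
    ≡⟨ cong₂ _+_ (∑∑-* (𝟙 ∘ κ) (𝟙 ∘ κ)) (∑∑-point (𝟙 ∘ not ∘ κ) (λ i → i)) ⟩
  c * c + d                ≡⟨ cong (_+ d) (2*nC2+n c) ⟨
  2 * (c C 2) + c + d      ≡⟨ +-assoc _ c d ⟩
  2 * (c C 2) + (c + d)    ∎))
  where
  open ≡-Reasoning
  c = card κ
  d = card (not ∘ κ)
  pointwise : ∀ i j → closedAdj G i j ≡ 𝟙 (κ i) * 𝟙 (κ j) + 𝟙 (not (κ i)) * 𝟙 (j == i)
  pointwise i j with i ≟ j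
  ... | yes refl rewrite closedAdj-diag G i | ==-refl i with κ i
  ...   | true  = refl
  ...   | false = refl
  pointwise i j | no i≢j
    rewrite closedAdj-off G i≢j | determined-off (Gκ i j) i≢j | ==-false {i = j} {i} (i≢j ∘ ≡-sym)
    with κ i | κ j
  ... | true  | true  = refl
  ... | true  | false = refl
  ... | false | true  = refl
  ... | false | false = refl

split-edges : (G : Graph) (κ : Fin (n G) → Bool) → SplitOn G κ →
  edges G ≡ card (not ∘ κ) * card κ + card κ C 2
split-edges G κ Gκ = *-cancelˡ-≡ _ _ 2 (+-cancelʳ-≡ (c + d) _ _ (begin
  2 * edges G + (c + d)    ≡⟨ cong (2 * edges G +_) (card-not κ) ⟩
  2 * edges G + n G        ≡⟨ 2*edges+n G ⟩
  ∑∑ (closedAdj G)         ≡⟨ ∑∑-cong pointwise ⟩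
  ∑∑ (λ i j → 𝟙 (κ i) * 1 + (𝟙 (not (κ i)) * 𝟙 (κ j) + 𝟙 (not (κ i)) * 𝟙 (j == i)))
    ≡⟨ trans (∑∑-+ _ _) (cong (∑∑ (λ i j → 𝟙 (κ i) * 1) +_) (∑∑-+ _ _)) ⟩
  ∑∑ (λ i j → 𝟙 (κ i) * 1)
    + (∑∑ (λ i j → 𝟙 (not (κ i)) * 𝟙 (κ j)) + ∑∑ (λ i j → 𝟙 (not (κ i)) * 𝟙 (j == i)))
    ≡⟨ cong₂ _+_ (trans (∑∑-* (𝟙 ∘ κ) (λ _ → 1)) (cong (c *_) (trans (sum-one (n G)) (≡-sym (card-not κ)))))
         (cong₂ _+_ (∑∑-* (𝟙 ∘ not ∘ κ) (𝟙 ∘ κ)) (∑∑-point (𝟙 ∘ not ∘ κ) (λ i → i))) ⟩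
  c * (c + d) + (d * c + d)               ≡⟨ regroup c d ⟩
  2 * (d * c) + d + c * c                 ≡⟨ cong (2 * (d * c) + d +_) (2*nC2+n c) ⟨
  2 * (d * c) + d + (2 * (c C 2) + c)     ≡⟨ collect (d * c) c d (c C 2) ⟩
  2 * (d * c + c C 2) + (c + d)           ∎))
  where
  open ≡-Reasoning
  c = card κ
  d = card (not ∘ κ)
  regroup : ∀ c d → c * (c + d) + (d * c + d) ≡ 2 * (d * c) + d + c * c
  regroup = solve-∀
  collect : ∀ p c d b → 2 * p + d + (2 * b + c) ≡ 2 * (p + b) + (c + d)
  collect = solve-∀
  pointwise : ∀ i j → closedAdj G i j ≡
    𝟙 (κ i) * 1 + (𝟙 (not (κ i)) * 𝟙 (κ j) + 𝟙 (not (κ i)) * 𝟙 (j == i))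
  pointwise i j with i ≟ j
  ... | yes refl rewrite closedAdj-diag G i | ==-refl i with κ i
  ...   | true  = refl
  ...   | false = refl
  pointwise i j | no i≢j
    rewrite closedAdj-off G i≢j | determined-off (Gκ i j) i≢j | ==-false {i = j} {i} (i≢j ∘ ≡-sym)
    with κ i | κ j
  ... | true  | _     = refl
  ... | false | true  = refl
  ... | false | false = refl

-- The extremal graphs

inK : ∀ α ν → Fin (n (Gαν α ν)) → Bool
inK α ν i = does (toℕ i <? 2 * ν + 1)

Gαν-clique : ∀ α ν → CliqueOn (Gαν α ν) (inK α ν)
Gαν-clique α ν i j = refl

card-inK : ∀ α ν → card (inK α ν) ≡ 2 * ν + 1
card-inK α ν = card-<ᵇ (m≤m+n _ _)

card-¬inK : ∀ α ν → card (not ∘ inK α ν) ≡ α ∸ 1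
card-¬inK α ν = +-cancelˡ-≡ (2 * ν + 1) _ _
  (trans (cong (_+ card (not ∘ inK α ν)) (≡-sym (card-inK α ν))) (card-not (inK α ν)))

big : ∀ α ν → Fin (n (Hαν α ν)) → Bool
big α ν i = does (α ≤? toℕ i)

Hαν-split : ∀ α ν → SplitOn (Hαν α ν) (big α ν)
Hαν-split α ν i j = refl

card-¬big : ∀ α ν → card (not ∘ big α ν) ≡ α
card-¬big α ν = trans (sum-cong λ i → cong 𝟙 (not-≤ᵇ α (toℕ i))) (card-<ᵇ (m≤m+n α ν))
  where
  not-≤ᵇ : ∀ a x → not (a ≤ᵇ x) ≡ (x <ᵇ a)
  not-≤ᵇ zero    zero    = refl
  not-≤ᵇ zero    (suc x) = refl
  not-≤ᵇ (suc a) zero    = refl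
  not-≤ᵇ (suc zero)    (suc x) = refl
  not-≤ᵇ (suc (suc a)) (suc x) = not-≤ᵇ (suc a) x

card-big : ∀ α ν → card (big α ν) ≡ ν
card-big α ν = +-cancelʳ-≡ α _ _
  (trans (cong (card (big α ν) +_) (≡-sym (card-¬big α ν))) (trans (card-not (big α ν)) (+-comm α ν)))

Gαν-InE1 : ∀ α ν → 1 ≤ α → InE1 α ν ((2 * ν + 1) C 2) (Gαν α ν)
Gαν-InE1 α@(suc _) ν _ =
  subst (IndepNum (Gαν α ν)) (cong suc (card-¬inK α ν))
    (clique-indepNum (Gαν α ν) (inK α ν) (Gαν-clique α ν)
      (subst (1 ≤_) (trans (+-comm 1 (2 * ν)) (≡-sym (card-inK α ν))) (s≤s z≤n)))
  , clique-matchNum (Gαν α ν) (inK α ν) (Gαν-clique α ν) (card-inK α ν)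
  , trans (clique-edges (Gαν α ν) (inK α ν) (Gαν-clique α ν)) (cong (_C 2) (card-inK α ν))

-- For `α < ν` the graph would have fewer than `2 * ν` vertices and hence no matching with `ν`
-- edges.
Hαν-InE1 : ∀ α ν → 1 ≤ α → ν ≤ α → InE1 α ν (α * ν + ν C 2) (Hαν α ν)
Hαν-InE1 α ν 1≤α ν≤α =
  subst (IndepNum (Hαν α ν)) (card-¬big α ν)
    (split-indepNum (Hαν α ν) (big α ν) (Hαν-split α ν) (subst (1 ≤_) (≡-sym (card-¬big α ν)) 1≤α))
  , subst (MatchNum (Hαν α ν)) (card-big α ν)
      (split-matchNum (Hαν α ν) (big α ν) (Hαν-split α ν)
        (subst₂ _≤_ (≡-sym (card-big α ν)) (≡-sym (card-¬big α ν)) ν≤α))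
  , trans (split-edges (Hαν α ν) (big α ν) (Hαν-split α ν))
      (cong₂ (λ d c → d * c + c C 2) (card-¬big α ν) (card-big α ν))

-- Comparison of the edge bound with the two extremal values

splitEdges≡ : ∀ α ν → 2 * (α * ν + ν C 2) + ν ≡ 2 * (α * ν) + ν * ν
splitEdges≡ α ν = begin
  2 * (α * ν + ν C 2) + ν       ≡⟨ cong (_+ ν) (*-distribˡ-+ 2 (α * ν) (ν C 2)) ⟩
  2 * (α * ν) + 2 * (ν C 2) + ν ≡⟨ +-assoc (2 * (α * ν)) (2 * (ν C 2)) ν ⟩
  2 * (α * ν) + (2 * (ν C 2) + ν) ≡⟨ cong (2 * (α * ν) +_) (2*nC2+n ν) ⟩
  2 * (α * ν) + ν * ν           ∎
  where open ≡-Reasoning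

-- Twice the difference of the two edge numbers is `ν` times the difference of `2 * α` and
-- `3 * (ν + 1)`; this is the origin of the threshold.
boundary : ∀ α ν → 2 * α ≡ 3 * (ν + 1) → (2 * ν + 1) C 2 ≡ α * ν + ν C 2
boundary α ν eq = *-cancelˡ-≡ _ _ 2 (+-cancelʳ-≡ (2 * ν + 1 + ν) _ _ (begin
  2 * ((2 * ν + 1) C 2) + (2 * ν + 1 + ν)     ≡⟨ +-assoc (2 * ((2 * ν + 1) C 2)) (2 * ν + 1) ν ⟨
  2 * ((2 * ν + 1) C 2) + (2 * ν + 1) + ν     ≡⟨ cong (_+ ν) (2*nC2+n (2 * ν + 1)) ⟩
  (2 * ν + 1) * (2 * ν + 1) + ν               ≡⟨ expand ν ⟩
  3 * (ν + 1) * ν + ν * ν + (2 * ν + 1)       ≡⟨ cong (λ z → z * ν + ν * ν + (2 * ν + 1)) eq ⟨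
  2 * α * ν + ν * ν + (2 * ν + 1)             ≡⟨ cong (λ z → z + ν * ν + (2 * ν + 1)) (*-assoc 2 α ν) ⟩
  2 * (α * ν) + ν * ν + (2 * ν + 1)           ≡⟨ cong (_+ (2 * ν + 1)) (splitEdges≡ α ν) ⟨
  2 * (α * ν + ν C 2) + ν + (2 * ν + 1)       ≡⟨ swap (α * ν + ν C 2) ν ⟩
  2 * (α * ν + ν C 2) + (2 * ν + 1 + ν)       ∎))
  where
  open ≡-Reasoning
  expand : ∀ ν → (2 * ν + 1) * (2 * ν + 1) + ν ≡ 3 * (ν + 1) * ν + ν * ν + (2 * ν + 1)
  expand = solve-∀
  swap : ∀ e ν → 2 * e + ν + (2 * ν + 1) ≡ 2 * e + (2 * ν + 1 + ν)
  swap = solve-∀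

-- This is `total` with the number of vertices expanded, a polynomial in three numbers: twice the
-- edge bound plus `s + u + 2 * k`.
totalEdges : (s u k : ℕ) → ℕ
totalEdges s u k = s * (s + u + 2 * k) + ((u + 2 * k) * s + (2 * k * (2 * k) + (2 * k + (2 * k + u))))

-- The convexity of the bound in s: its distance to the value at s = 0 here, and
-- (with α = u + d) to the value at k = 0 in splitGap.
cliqueGap : ∀ s u k z → 2 * u + z ≡ 3 * (s + k + 1) →
  totalEdges s u k + s * (k + z) ≡ 2 * ((2 * (s + k) + 1) C 2) + (s + u + 2 * k)
-- The hypothesis is used multiplied by `s`: that multiple is added to both sides and one copy is
-- rewritten, which leaves a polynomial identity.
cliqueGap s u k z eq = +-cancelʳ-≡ (2 * (s + k) + 1 + s * (2 * u + z)) _ _ (begin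
  totalEdges s u k + s * (k + z) + (2 * (s + k) + 1 + s * (2 * u + z))
    ≡⟨ cong (λ y → totalEdges s u k + s * (k + z) + (2 * (s + k) + 1 + s * y)) eq ⟩
  totalEdges s u k + s * (k + z) + (2 * (s + k) + 1 + s * (3 * (s + k + 1)))
    ≡⟨ poly s u k z ⟩
  (2 * (s + k) + 1) * (2 * (s + k) + 1) + (s + u + 2 * k + s * (2 * u + z))
    ≡⟨ cong (_+ (s + u + 2 * k + s * (2 * u + z))) (2*nC2+n (2 * (s + k) + 1)) ⟨
  2 * ((2 * (s + k) + 1) C 2) + (2 * (s + k) + 1) + (s + u + 2 * k + s * (2 * u + z))
    ≡⟨ swap (2 * ((2 * (s + k) + 1) C 2)) (2 * (s + k) + 1) (s + u + 2 * k) (s * (2 * u + z)) ⟩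
  2 * ((2 * (s + k) + 1) C 2) + (s + u + 2 * k) + (2 * (s + k) + 1 + s * (2 * u + z)) ∎)
  where
  open ≡-Reasoning
  poly : ∀ s u k z →
    s * (s + u + 2 * k) + ((u + 2 * k) * s + (2 * k * (2 * k) + (2 * k + (2 * k + u)))) + s * (k + z)
      + (2 * (s + k) + 1 + s * (3 * (s + k + 1)))
    ≡ (2 * (s + k) + 1) * (2 * (s + k) + 1) + (s + u + 2 * k + s * (2 * u + z))
  poly = solve-∀
  swap : ∀ a b c d → a + b + (c + d) ≡ a + c + (b + d)
  swap = solve-∀

splitGap : ∀ s u k d w → 2 * (u + d) ≡ 3 * (s + k + 1) + w →
  totalEdges s u k + (k * (s + w) + 2 * (d * s))
    ≡ 2 * ((u + d) * (s + k) + (s + k) C 2) + (s + u + 2 * k)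
-- As for the clique, but the hypothesis is used multiplied by `k`.
splitGap s u k d w eq = +-cancelʳ-≡ (s + k + k * (3 * (s + k + 1) + w)) _ _ (begin
  totalEdges s u k + (k * (s + w) + 2 * (d * s)) + (s + k + k * (3 * (s + k + 1) + w))
    ≡⟨ cong (λ y → totalEdges s u k + (k * (s + w) + 2 * (d * s)) + (s + k + k * y)) eq ⟨
  totalEdges s u k + (k * (s + w) + 2 * (d * s)) + (s + k + k * (2 * (u + d)))
    ≡⟨ poly s u k d w ⟩
  2 * ((u + d) * (s + k)) + (s + k) * (s + k) + (s + u + 2 * k + k * (3 * (s + k + 1) + w))
    ≡⟨ cong (_+ (s + u + 2 * k + k * (3 * (s + k + 1) + w))) (splitEdges≡ (u + d) (s + k)) ⟨
  2 * ((u + d) * (s + k) + (s + k) C 2) + (s + k) + (s + u + 2 * k + k * (3 * (s + k + 1) + w))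
    ≡⟨ swap (2 * ((u + d) * (s + k) + (s + k) C 2)) (s + k) (s + u + 2 * k) (k * (3 * (s + k + 1) + w)) ⟩
  2 * ((u + d) * (s + k) + (s + k) C 2) + (s + u + 2 * k) + (s + k + k * (3 * (s + k + 1) + w)) ∎)
  where
  open ≡-Reasoning
  poly : ∀ s u k d w →
    s * (s + u + 2 * k) + ((u + 2 * k) * s + (2 * k * (2 * k) + (2 * k + (2 * k + u))))
      + (k * (s + w) + 2 * (d * s)) + (s + k + k * (2 * (u + d)))
    ≡ 2 * ((u + d) * (s + k)) + (s + k) * (s + k) + (s + u + 2 * k + k * (3 * (s + k + 1) + w))
  poly = solve-∀
  swap : ∀ a b c d → a + b + (c + d) ≡ a + c + (b + d)
  swap = solve-∀

module Extremal (G : Graph) (α ν : ℕ) (1≤ν : 1 ≤ ν) (indep : IndepNum G α) (match : MatchNum G ν) where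
  open Counting G ν (reduced G ν match)

  total≡ : total ≡ totalEdges s u k
  total≡ = cong (λ N → s * N + ((u + 2 * k) * s + (2 * k * (2 * k) + (2 * k + (2 * k + u))))) n≡

  bound-from-gap : ∀ {e gap} → totalEdges s u k + gap ≡ 2 * e + (s + u + 2 * k) → edges G ≤ e
  bound-from-gap {e} {gap} eq = *-cancelˡ-≤ 2 (+-cancelʳ-≤ (s + u + 2 * k) _ _ (begin
    2 * edges G + (s + u + 2 * k) ≡⟨ cong (2 * edges G +_) n≡ ⟨
    2 * edges G + n G             ≤⟨ edges-bound ⟩
    total                         ≡⟨ total≡ ⟩
    totalEdges s u k              ≤⟨ m≤m+n _ gap ⟩
    totalEdges s u k + gap        ≡⟨ eq ⟩
    2 * e + (s + u + 2 * k)       ∎))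
    where open ≤-Reasoning

  gap≡0 : ∀ {e gap} → totalEdges s u k + gap ≡ 2 * e + (s + u + 2 * k) → edges G ≡ e → gap ≡ 0
  gap≡0 {gap = gap} eq refl = n≤0⇒n≡0 (+-cancelˡ-≤ (totalEdges s u k) _ _ (begin
    totalEdges s u k + gap        ≡⟨ eq ⟩
    2 * edges G + (s + u + 2 * k) ≡⟨ cong (2 * edges G +_) n≡ ⟨
    2 * edges G + n G             ≤⟨ edges-bound ⟩
    total                         ≡⟨ total≡ ⟩
    totalEdges s u k              ≡⟨ +-identityʳ _ ⟨
    totalEdges s u k + 0          ∎))
    where open ≤-Reasoning

  tight : ∀ {e gap} → totalEdges s u k + gap ≡ 2 * e + (s + u + 2 * k) → edges G ≡ e →
    total ≤ 2 * edges G + n G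
  tight {gap = gap} eq refl = begin
    total                         ≡⟨ total≡ ⟩
    totalEdges s u k              ≤⟨ m≤m+n _ gap ⟩
    totalEdges s u k + gap        ≡⟨ eq ⟩
    2 * edges G + (s + u + 2 * k) ≡⟨ cong (2 * edges G +_) n≡ ⟨
    2 * edges G + n G             ∎
    where open ≤-Reasoning

  -- At `s = 0` the number `u` cancels from the edge bound, so equality does not determine it; the
  -- number of isolated vertices comes from the independence number instead.
  s≡0⇒≅ : total ≤ 2 * edges G + n G → s ≡ 0 → G ≅ Gαν α ν
  s≡0⇒≅ tight s≡0 = fromClique (Tight.s≡0⇒clique tight s≡0 (subst (1 ≤_) (≡-sym k≡ν) 1≤ν))
    where
    k≡ν : k ≡ ν
    k≡ν = trans (cong (_+ k) (≡-sym s≡0)) size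
    fromClique : (∃ λ κ → card κ ≡ 2 * k + 1 × CliqueOn G κ) → G ≅ Gαν α ν
    fromClique (κ , card-κ , Gκ) = determined-≅ _∧_ G (Gαν α ν) κ (inK α ν) Gκ (Gαν-clique α ν)
      (trans card-κ (trans (cong (λ k → 2 * k + 1) k≡ν) (≡-sym (card-inK α ν))))
      (trans (cong (_∸ 1) card-¬κ) (≡-sym (card-¬inK α ν)))
      where
      card-¬κ : suc (card (not ∘ κ)) ≡ α
      card-¬κ = indepNum-unique G (clique-indepNum G κ Gκ
        (subst (1 ≤_) (≡-sym (trans card-κ (+-comm (2 * k) 1))) (s≤s z≤n))) indep

  k≡0⇒≅ : total ≤ 2 * edges G + n G → k ≡ 0 → u ≡ α → G ≅ Hαν α ν
  k≡0⇒≅ tight k≡0 u≡α = determined-≅ _∨_ G (Hαν α ν) S (big α ν)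
    (Tight.k≡0⇒split tight k≡0) (Hαν-split α ν)
    (trans s≡ν (≡-sym (card-big α ν)))
    (trans card-¬S (trans (cong (λ k → u + 2 * k) k≡0)
      (trans (+-identityʳ u) (trans u≡α (≡-sym (card-¬big α ν))))))
    where
    s≡ν : s ≡ ν
    s≡ν = trans (≡-sym (+-identityʳ s)) (trans (cong (s +_) (≡-sym k≡0)) size)

  d : ℕ
  d = proj₁ (m≤n⇒∃[o]m+o≡n (u≤ indep))

  u+d≡α : u + d ≡ α
  u+d≡α = proj₂ (m≤n⇒∃[o]m+o≡n (u≤ indep))

  2u+2d : ∀ w → 2 * u + (2 * d + w) ≡ 2 * α + w
  2u+2d w = trans (≡-sym (+-assoc (2 * u) (2 * d) w))
    (cong (_+ w) (trans (≡-sym (*-distribˡ-+ 2 u d)) (cong (2 *_) u+d≡α)))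

  -- Passing from `α` to `u` enlarges the slack by `2 * d`, which only widens the gap, so `u < α`
  -- needs no separate case.
  cliqueGapαν : ∀ w → 2 * α + w ≡ 3 * (ν + 1) →
    totalEdges s u k + s * (k + (2 * d + w)) ≡ 2 * ((2 * ν + 1) C 2) + (s + u + 2 * k)
  cliqueGapαν w eq = subst (λ ν → totalEdges s u k + s * (k + (2 * d + w)) ≡ 2 * ((2 * ν + 1) C 2) + (s + u + 2 * k))
    size (cliqueGap s u k (2 * d + w)
      (trans (2u+2d w) (trans eq (cong (λ ν → 3 * (ν + 1)) (≡-sym size)))))

  splitGapαν : ∀ w → 2 * α ≡ 3 * (ν + 1) + w →
    totalEdges s u k + (k * (s + w) + 2 * (d * s)) ≡ 2 * (α * ν + ν C 2) + (s + u + 2 * k)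
  splitGapαν w eq = subst₂ (λ α ν → totalEdges s u k + (k * (s + w) + 2 * (d * s)) ≡ 2 * (α * ν + ν C 2) + (s + u + 2 * k))
    u+d≡α size (splitGap s u k d w
      (trans (cong (2 *_) u+d≡α) (trans eq (cong (λ ν → 3 * (ν + 1) + w) (≡-sym size)))))

  -- With `k = 0` the set `S` has `ν` elements and is nonempty, so the deficit `d` must vanish.
  k≡0⇒u≡α : k ≡ 0 → 2 * (d * s) ≡ 0 → u ≡ α
  k≡0⇒u≡α k≡0 2ds≡0 with m*n≡0⇒m≡0∨n≡0 2 2ds≡0
  ... | inj₂ ds≡0 with m*n≡0⇒m≡0∨n≡0 d ds≡0
  ...   | inj₁ d≡0 = trans (≡-sym (+-identityʳ u)) (trans (cong (u +_) (≡-sym d≡0)) u+d≡α)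
  ...   | inj₂ s≡0 with () ← subst (1 ≤_) (trans (≡-sym size) (cong₂ _+_ s≡0 k≡0)) 1≤ν

  below : 2 * α < 3 * (ν + 1) →
    edges G ≤ (2 * ν + 1) C 2 × (edges G ≡ (2 * ν + 1) C 2 → G ≅ Gαν α ν)
  below 2α< with w , eq ← m≤n⇒∃[o]m+o≡n 2α< =
    bound-from-gap gap , λ e≡ → s≡0⇒≅ (tight gap e≡) (s≡0 (m*n≡0⇒m≡0∨n≡0 s (gap≡0 gap e≡)))
    where
    -- Strictness makes the slack `suc w`, so the second factor of the gap is positive and a zero
    -- gap means `s = 0`.
    gap = cliqueGapαν (suc w) (trans (+-suc (2 * α) w) eq)
    s≡0 : s ≡ 0 ⊎ k + (2 * d + suc w) ≡ 0 → s ≡ 0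
    s≡0 (inj₁ s≡0) = s≡0
    s≡0 (inj₂ eq₀) with () ← m+n≡0⇒n≡0 (2 * d) (m+n≡0⇒n≡0 k eq₀)

  beyond : 2 * α > 3 * (ν + 1) →
    edges G ≤ α * ν + ν C 2 × (edges G ≡ α * ν + ν C 2 → G ≅ Hαν α ν)
  beyond 2α> with w , eq ← m≤n⇒∃[o]m+o≡n 2α> =
    bound-from-gap gap , λ e≡ →
      let zero-gap = gap≡0 gap e≡
          k≡0 = k≡0 (m*n≡0⇒m≡0∨n≡0 k (m+n≡0⇒m≡0 (k * (s + suc w)) zero-gap))
      in k≡0⇒≅ (tight gap e≡) k≡0 (k≡0⇒u≡α k≡0 (m+n≡0⇒n≡0 (k * (s + suc w)) zero-gap))
    where
    -- Here strictness makes `s + suc w` positive, so a zero gap means `k = 0`.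
    gap = splitGapαν (suc w) (trans (≡-sym eq) (≡-sym (+-suc (3 * (ν + 1)) w)))
    k≡0 : k ≡ 0 ⊎ s + suc w ≡ 0 → k ≡ 0
    k≡0 (inj₁ k≡0) = k≡0
    k≡0 (inj₂ eq₀) with () ← m+n≡0⇒n≡0 s eq₀

  at : 2 * α ≡ 3 * (ν + 1) →
    edges G ≤ (2 * ν + 1) C 2
    × (edges G ≡ (2 * ν + 1) C 2 → Any (G ≅_) (Gαν α ν ∷ Hαν α ν ∷ []))
  at eq = bound-from-gap gap , λ e≡ →
      let zero-gap = gap≡0 gap e≡
          ks≡0 = m+n≡0⇒m≡0 (k * (s + 0)) zero-gap
          ds≡0 = m+n≡0⇒n≡0 (k * (s + 0)) zero-gap
      in which (tight gap e≡) ds≡0 (m*n≡0⇒m≡0∨n≡0 k ks≡0)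
    where
    -- With no slack the first part of the gap is `k * s`: it vanishes at both ends, and each end
    -- yields one extremal graph.
    gap = trans (splitGapαν 0 (trans eq (≡-sym (+-identityʳ _))))
      (cong (λ e → 2 * e + (s + u + 2 * k)) (≡-sym (boundary α ν eq)))
    which : total ≤ 2 * edges G + n G → 2 * (d * s) ≡ 0 → k ≡ 0 ⊎ s + 0 ≡ 0 →
      Any (G ≅_) (Gαν α ν ∷ Hαν α ν ∷ [])
    which tight ds≡0 (inj₁ k≡0)   = there (here (k≡0⇒≅ tight k≡0 (k≡0⇒u≡α k≡0 ds≡0)))
    which tight ds≡0 (inj₂ s+0≡0) = here (s≡0⇒≅ tight (m+n≡0⇒m≡0 s s+0≡0))

3*[ν+1]≤2*α⇒ν≤α : ∀ α ν → 3 * (ν + 1) ≤ 2 * α → ν ≤ α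
3*[ν+1]≤2*α⇒ν≤α α ν 3[ν+1]≤2α = *-cancelˡ-≤ 2
  (≤-trans (*-mono-≤ {2} {3} (s≤s (s≤s z≤n)) (m≤m+n ν 1)) 3[ν+1]≤2α)

theorem16 : (α ν : ℕ) → 1 ≤ α → 1 ≤ ν →
    (2 * α < 3 * (ν + 1) →
    ExtremalData α ν ((2 * ν + 1) C 2) (Gαν α ν ∷ []))
    × (2 * α > 3 * (ν + 1) →
    ExtremalData α ν (α * ν + ν C 2) (Hαν α ν ∷ []))
    × (2 * α ≡ 3 * (ν + 1) →
    ((2 * ν + 1) C 2 ≡ α * ν + ν C 2)
    × ExtremalData α ν ((2 * ν + 1) C 2) (Gαν α ν ∷ Hαν α ν ∷ []))
theorem16 α ν 1≤α 1≤ν =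
    (λ 2α< → (Gαν-InE1 α ν 1≤α ∷ [])
      , (λ G indep match → proj₁ (below G α ν 1≤ν indep match 2α<))
      , (λ G (indep , match , e≡) → here (proj₂ (below G α ν 1≤ν indep match 2α<) e≡)))
  , (λ 2α> → (Hαν-InE1 α ν 1≤α (3*[ν+1]≤2*α⇒ν≤α α ν (<⇒≤ 2α>)) ∷ [])
      , (λ G indep match → proj₁ (beyond G α ν 1≤ν indep match 2α>))
      , (λ G (indep , match , e≡) → here (proj₂ (beyond G α ν 1≤ν indep match 2α>) e≡)))
  , (λ 2α≡ → boundary α ν 2α≡
      , (Gαν-InE1 α ν 1≤α
        ∷ subst (λ e → InE1 α ν e (Hαν α ν)) (≡-sym (boundary α ν 2α≡))
            (Hαν-InE1 α ν 1≤α (3*[ν+1]≤2*α⇒ν≤α α ν (≤-reflexive (≡-sym 2α≡))))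
        ∷ [])
      , (λ G indep match → proj₁ (at G α ν 1≤ν indep match 2α≡))
      , (λ G (indep , match , e≡) → proj₂ (at G α ν 1≤ν indep match 2α≡) e≡))
  where open Extremal
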